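{- For every integer $n\geq 2$, $$a_n(3421,4321;213)=a_n(4312,4321;312)=F_{2n-3},$$ where $F_m$ is the $m$-th Fibonacci number.
   Context: A permutation $\pi$ of $[n]=\{1,\dots,n\}$ is cyclic if it consists of a single $n$-cycle. Its one-line notation is $\pi_1\pi_2\cdots\pi_n$ with $\pi_i=\pi(i)$. Its standard cycle form is $(c_1,c_2,\dots,c_n)$ with $c_1=1$ and $c_{i+1}=\pi(c_i)$ for $1\le i<n$. A sequence $w_1\cdots w_n$ of distinct integers contains a pattern $\sigma=\sigma_1\cdots\sigma_k\in S_k$ if there are indices $i_1<\dots<i_k$ with $w_{i_s}>w_{i_t}$ iff $\sigma_s>\sigma_t$ for all $s<t$; otherwise it avoids $\sigma$. $\mathcal{A}_n(\sigma_1,\dots,\sigma_l;\rho)$ is the set of cyclic permutations of $[n]$ whose one-line notation avoids each $\sigma_i$ and whose standard cycle form $c_1\cdots c_n$, read as a sequence, avoids $\rho$; $a_n(\sigma_1,\dots,\sigma_l;\rho)$ is its cardinality. Fibonacci numbers: $F_0=0$, $F_1=1$, $F_m=F_{m-1}+F_{m-2}$. -}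

module Defs where

open import Data.Nat using (ℕ; zero; suc; _≡ᵇ_; _<ᵇ_)
open import Data.Bool using (Bool; true; false; not; _∧_)
open import Data.List using (List; []; _∷_; [_]; _++_; map; concatMap; upTo; length; filter)
open import Data.Bool.ListAction using (any; all)
open import Relation.Nullary.Decidable using (yes; no)
open import Data.Bool.Properties using (T?)
open import Data.Bool using (T)

fib : ℕ → ℕ
fib zero = 0
fib (suc zero) = 1
fib (suc (suc m)) = fib (suc m) Data.Nat.+ fib m

oneTo : ℕ → List ℕ
oneTo m = map suc (upTo m)

words : ℕ → ℕ → List (List ℕ)
words m zero = [ [] ]
words m (suc k) = concatMap (λ x → map (x ∷_) (words m k)) (oneTo m)

allDistinct : List ℕ → Bool
allDistinct [] = true
allDistinct (x ∷ xs) = not (any (x ≡ᵇ_) xs) ∧ allDistinct xs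

subseqs : List ℕ → List (List ℕ)
subseqs [] = [ [] ]
subseqs (x ∷ xs) = map (x ∷_) (subseqs xs) ++ subseqs xs

-- u and σ are order-isomorphic: same length and for all s < t,
-- u_s > u_t iff σ_s > σ_t
orderIso : List ℕ → List ℕ → Bool
orderIso [] [] = true
orderIso [] (_ ∷ _) = false
orderIso (_ ∷ _) [] = false
orderIso (a ∷ as) (b ∷ bs) = pairs as bs ∧ orderIso as bs
  where
  pairs : List ℕ → List ℕ → Bool
  pairs [] [] = true
  pairs [] (_ ∷ _) = false
  pairs (_ ∷ _) [] = false
  pairs (a' ∷ as') (b' ∷ bs') = (eqB (a' <ᵇ a) (b' <ᵇ b)) ∧ pairs as' bs'
    where
    eqB : Bool → Bool → Bool
    eqB true y = y
    eqB false y = not y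

contains : List ℕ → List ℕ → Bool
contains w σ = any (λ u → orderIso u σ) (subseqs w)

avoids : List ℕ → List ℕ → Bool
avoids w σ = not (contains w σ)

-- π(i) for a permutation in one-line notation w = π(1)…π(n) (0 if out of range)
apply : List ℕ → ℕ → ℕ
apply [] _ = 0
apply (x ∷ xs) zero = 0
apply (x ∷ xs) (suc zero) = x
apply (x ∷ xs) (suc (suc i)) = apply xs (suc i)

cycleForm : List ℕ → List ℕ
cycleForm w = go (length w) 1
  where
  go : ℕ → ℕ → List ℕ
  go zero _ = []
  go (suc k) x = x ∷ go k (apply w x)

-- a permutation of [n] is a single n-cycle iff 1, π(1), …, π^{n-1}(1) are distinct
isCyclic : List ℕ → Bool
isCyclic w = allDistinct (cycleForm w)

perms : ℕ → List (List ℕ)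
perms n = filter (λ w → T? (allDistinct w)) (words n n)

𝒜 : ℕ → List (List ℕ) → List ℕ → List (List ℕ)
𝒜 n σs ρ = filter (λ w → T? (isCyclic w ∧ all (avoids w) σs ∧ avoids (cycleForm w) ρ)) (perms n)

a : ℕ → List (List ℕ) → List ℕ → ℕ
a n σs ρ = length (𝒜 n σs ρ)

{-# OPTIONS --safe #-}
-- Write a cyclic permutation through its cycle form 1, c₂, …, cₙ. In the first family (one-line notation
-- avoiding 3421 and 4321, cycle form avoiding 213) either c₂ = 2, and removing 2 leaves a member of size n − 1,
-- or 2 comes later. Then avoiding 213 forces every entry after 2 to be smaller than every entry before it, and
-- avoiding 4321 forces the entries from 2 on to be 2, 3, …, c + 2; removing this final run leaves a member of
-- size n − c − 1. Both insertions preserve the avoidance conditions, so a(n + 1) = a(n) + a(2) + ⋯ + a(n) with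
-- a(2) = 1, the recurrence of F(2n − 3) because F(1) + F(3) + ⋯ + F(2n − 3) = F(2n − 2).
-- Inversion maps the first family onto the second: it reverses the cycle form, turning 213 into 312, and
-- inverts the patterns of the one-line notation, turning 3421 into 4312 and fixing 4321.

module Submission where

open import Defs
open import Data.Nat
open import Data.Nat.Properties
open import Data.Product using (∃-syntax; _×_; _,_; proj₁; proj₂)
open import Data.Sum using (_⊎_; inj₁; inj₂)
open import Data.Empty using (⊥; ⊥-elim)
open import Data.Unit using (⊤)
open import Relation.Nullary using (¬_; yes; no)
open import Relation.Binary using (tri<; tri≈; tri>)
open import Relation.Binary.PropositionalEquality hiding ([_])
open import Function.Base using (_∘_; id)
open import Data.Nat.Induction using (<-rec)
open import Data.Bool using (true; false; not; _∧_; T)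
open import Data.Bool.Properties using (T?; T-∧; T-not-≡; T-≡)
open import Data.Bool.ListAction using (all)
open import Data.List using (List; []; _∷_; [_]; _++_; map; concatMap; applyUpTo; upTo; length; iterate)
open import Data.List.Properties using (length-applyUpTo; length-map; length-++; map-∘; map-++; map-cong; map-cong-local; ∷-injectiveˡ; ∷-injectiveʳ; applyUpTo-∷ʳ)
open import Data.List.Membership.Propositional using (_∈_; find; lose)
open import Data.List.Membership.Propositional.Properties
  using (∈-map⁺; ∈-map⁻; ∈-++⁺ˡ; ∈-++⁺ʳ; ∈-++⁻; ∈-concatMap⁺; ∈-concatMap⁻; ∈-applyUpTo⁺; ∈-upTo⁺; ∈-upTo⁻; ∈-filter⁺; ∈-filter⁻)
open import Data.List.Relation.Unary.Any as AnyM using (here; there)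
open import Data.List.Relation.Unary.Any.Properties using (any⁺; any⁻)
open import Data.List.Relation.Unary.All as All using (All; []; _∷_)
import Data.List.Relation.Unary.All.Properties as Allₚ
open import Data.List.Relation.Unary.AllPairs as AllPairs using ([]; _∷_)
import Data.List.Relation.Unary.AllPairs.Properties as AllPairsₚ
open import Data.List.Relation.Unary.Unique.Propositional using (Unique)
import Data.List.Relation.Unary.Unique.Propositional.Properties as Unique
open import Data.List.Relation.Binary.Disjoint.Propositional using (Disjoint)
open import Data.List.Membership.Propositional.Properties.WithK using (unique∧set⇒bag)
open import Data.List.Relation.Binary.BagAndSetEquality using (∼bag⇒↭)
open import Data.List.Relation.Binary.Permutation.Propositional.Properties using (↭-length)
open import Data.Nat.ListAction using (sum)
open import Data.Nat.ListAction.Properties using (sum-++)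
open import Function.Bundles using (_⇔_; mk⇔; Equivalence)

-- Permutations of [1, n] as functions

Within : ℕ → ℕ → Set
Within n v = 1 ≤ v × v ≤ n

injective⇒surjective : ∀ n (f : ℕ → ℕ) → (∀ {i} → i < n → f i < n) →
  (∀ {i j} → i < n → j < n → f i ≡ f j → i ≡ j) → ∀ {y} → y < n → ∃[ i ] i < n × f i ≡ y
injective⇒surjective zero f into inj ()
injective⇒surjective (suc n) f into inj {y} y<1+n = hit (m≤n⇒m<n∨m≡n (≤-pred y<1+n))
  where
  -- Redirecting the value n to f n leaves an injective map of [0, n) into itself.
  g : ℕ → ℕ
  g i with f i ≟ n
  ... | yes _ = f n
  ... | no _ = f i

  fn≢n : ∀ {i} → i < n → f i ≡ n → f n ≢ n
  fn≢n {i} i<n fi≡n fn≡n = <-irrefl (inj (m<n⇒m<1+n i<n) ≤-refl (trans fi≡n (sym fn≡n))) i<n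

  g-into : ∀ {i} → i < n → g i < n
  g-into {i} i<n with f i ≟ n
  ... | yes fi≡n = ≤∧≢⇒< (≤-pred (into ≤-refl)) (fn≢n i<n fi≡n)
  ... | no fi≢n = ≤∧≢⇒< (≤-pred (into (m<n⇒m<1+n i<n))) fi≢n

  g-inj : ∀ {i j} → i < n → j < n → g i ≡ g j → i ≡ j
  g-inj {i} {j} i<n j<n e with f i ≟ n | f j ≟ n
  ... | yes fi≡n | yes fj≡n = inj (m<n⇒m<1+n i<n) (m<n⇒m<1+n j<n) (trans fi≡n (sym fj≡n))
  ... | yes _ | no _ = ⊥-elim (<-irrefl (sym (inj ≤-refl (m<n⇒m<1+n j<n) e)) j<n)
  ... | no _ | yes _ = ⊥-elim (<-irrefl (sym (inj ≤-refl (m<n⇒m<1+n i<n) (sym e))) i<n)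
  ... | no _ | no _ = inj (m<n⇒m<1+n i<n) (m<n⇒m<1+n j<n) e

  hit : y < n ⊎ y ≡ n → ∃[ i ] i < suc n × f i ≡ y
  hit (inj₁ y<n) with injective⇒surjective n g g-into g-inj y<n
  ... | i , i<n , gi≡y with f i ≟ n
  ...   | yes _ = n , ≤-refl , gi≡y
  ...   | no _ = i , m<n⇒m<1+n i<n , gi≡y
  hit (inj₂ refl) with f n ≟ n
  ... | yes fn≡n = n , ≤-refl , fn≡n
  ... | no fn≢n with injective⇒surjective n g g-into g-inj (≤∧≢⇒< (≤-pred (into ≤-refl)) fn≢n)
  ...   | i , i<n , gi≡fn with f i ≟ n
  ...     | yes fi≡n = i , m<n⇒m<1+n i<n , fi≡n
  ...     | no _ = ⊥-elim (<-irrefl (inj (m<n⇒m<1+n i<n) ≤-refl gi≡fn) i<n)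

injective⇒onto : ∀ n (f : ℕ → ℕ) → (∀ {i} → i < n → Within n (f i)) →
  (∀ {i j} → i < n → j < n → f i ≡ f j → i ≡ j) → ∀ y → Within n y → ∃[ i ] i < n × f i ≡ y
injective⇒onto n f into inj y (1≤y , y≤n) with injective⇒surjective n (pred ∘ f) into′ inj′ (pred-< 1≤y y≤n)
  where
  pred-< : ∀ {a} → 1 ≤ a → a ≤ n → pred a < n
  pred-< (s≤s _) a≤n = a≤n
  into′ : ∀ {i} → i < n → pred (f i) < n
  into′ i<n = pred-< (proj₁ (into i<n)) (proj₂ (into i<n))
  inj′ : ∀ {i j} → i < n → j < n → pred (f i) ≡ pred (f j) → i ≡ j
  inj′ i<n j<n e = inj i<n j<n (pred-injective {{>-nonZero (proj₁ (into i<n))}} {{>-nonZero (proj₁ (into j<n))}} e)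
... | i , i<n , e = i , i<n , pred-injective {{>-nonZero (proj₁ (into i<n))}} {{>-nonZero 1≤y}} e

MapsInto InjectiveOn : ℕ → (ℕ → ℕ) → Set
MapsInto n P = ∀ i → 1 ≤ i → i ≤ n → Within n (P i)
InjectiveOn n P = ∀ i j → 1 ≤ i → i ≤ n → 1 ≤ j → j ≤ n → P i ≡ P j → i ≡ j

injectiveOn⇒onto : ∀ {n P} → MapsInto n P → InjectiveOn n P → ∀ y → Within n y → ∃[ i ] Within n i × P i ≡ y
injectiveOn⇒onto {n} {P} into inj y y-within with injective⇒onto n (P ∘ suc) (λ i<n → into _ (s≤s z≤n) i<n)
                                        (λ i<n j<n → suc-injective ∘ inj _ _ (s≤s z≤n) i<n (s≤s z≤n) j<n) y y-within
... | i , i<n , e = suc i , (s≤s z≤n , i<n) , e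

orbit : (ℕ → ℕ) → ℕ → ℕ
orbit P zero = 1
orbit P (suc t) = P (orbit P t)

-- The cycle form 1, P 1, …, P^(n−1) 1 has no repetition, i.e. P is an n-cycle.
Cyclic : ℕ → (ℕ → ℕ) → Set
Cyclic n P = ∀ i j → i < n → j < n → orbit P i ≡ orbit P j → i ≡ j

2≰1 : ¬ 2 ≤ 1
2≰1 (s≤s ())

no-early-return : ∀ {S m} → (∀ t → 1 ≤ t → t < m → (∀ t′ → 1 ≤ t′ → t′ < t → 2 ≤ orbit S t′) → 2 ≤ orbit S t) →
  ∀ t → 1 ≤ t → t < m → 2 ≤ orbit S t
no-early-return {S} {m} step = <-rec (λ t → 1 ≤ t → t < m → 2 ≤ orbit S t)
  λ t earlier 1≤t t<m → step t 1≤t t<m λ t′ 1≤t′ t′<t → earlier t′<t 1≤t′ (<-trans t′<t t<m)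

module _ {n : ℕ} {P : ℕ → ℕ} (1≤n : 1 ≤ n) (into : MapsInto n P) where

  orbit-within : ∀ t → Within n (orbit P t)
  orbit-within zero = ≤-refl , 1≤n
  orbit-within (suc t) = into _ (proj₁ (orbit-within t)) (proj₂ (orbit-within t))

  module _ (inj : InjectiveOn n P) where

    orbit-cancel : ∀ a b → orbit P (suc a) ≡ orbit P (suc b) → orbit P a ≡ orbit P b
    orbit-cancel a b = inj _ _ (proj₁ (orbit-within a)) (proj₂ (orbit-within a)) (proj₁ (orbit-within b)) (proj₂ (orbit-within b))

    orbit-returns : ∀ i d → orbit P (i + d) ≡ orbit P i → orbit P d ≡ 1
    orbit-returns zero d e = e
    orbit-returns (suc i) d e = orbit-returns i d (orbit-cancel (i + d) i e)

    cyclic-if-no-early-return : (∀ t → 1 ≤ t → t < n → 2 ≤ orbit P t) → Cyclic n P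
    cyclic-if-no-early-return h i j i<n j<n e with <-cmp i j
    ... | tri≈ _ i≡j _ = i≡j
    ... | tri< i<j _ _ = ⊥-elim (2≰1 (subst (2 ≤_) (orbit-returns i (j ∸ i) (trans (cong (orbit P) (m+[n∸m]≡n (<⇒≤ i<j))) (sym e)))
                                      (h (j ∸ i) (m<n⇒0<n∸m i<j) (≤-<-trans (m∸n≤m j i) j<n))))
    ... | tri> _ _ j<i = ⊥-elim (2≰1 (subst (2 ≤_) (orbit-returns j (i ∸ j) (trans (cong (orbit P) (m+[n∸m]≡n (<⇒≤ j<i))) e))
                                      (h (i ∸ j) (m<n⇒0<n∸m j<i) (≤-<-trans (m∸n≤m i j) i<n))))

    module _ (cyc : Cyclic n P) where

      orbit-covers : ∀ v → Within n v → ∃[ t ] t < n × orbit P t ≡ v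
      orbit-covers = injective⇒onto n (orbit P) (λ {t} _ → orbit-within t) (cyc _ _)

      orbit≥2 : ∀ t → 1 ≤ t → t < n → 2 ≤ orbit P t
      orbit≥2 t 1≤t t<n = ≤∧≢⇒< (proj₁ (orbit-within t)) λ 1≡x → <-irrefl (sym (cyc t 0 t<n 1≤n (sym 1≡x))) 1≤t

      orbit-period : orbit P n ≡ 1
      orbit-period with orbit-covers (orbit P n) (orbit-within n)
      ... | zero , _ , 1≡ = sym 1≡
      ... | suc t , 1+t<n , e = ⊥-elim (2≰1 (subst (2 ≤_) returns (orbit≥2 (n ∸ suc t) (m<n⇒0<n∸m 1+t<n) (∸-monoʳ-< (s≤s z≤n) (<⇒≤ 1+t<n)))))
        where
        returns : orbit P (n ∸ suc t) ≡ 1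
        returns = orbit-returns (suc t) (n ∸ suc t) (trans (cong (orbit P) (m+[n∸m]≡n (<⇒≤ 1+t<n))) (sym e))

-- Pattern avoidance

Rel₄ Rel₃ : Set₁
Rel₄ = ℕ → ℕ → ℕ → ℕ → Set
Rel₃ = ℕ → ℕ → ℕ → Set

subst₄ : ∀ (R : Rel₄) {a a′ b b′ c c′ d d′} → a ≡ a′ → b ≡ b′ → c ≡ c′ → d ≡ d′ → R a b c d → R a′ b′ c′ d′
subst₄ R refl refl refl refl r = r

subst₃ : ∀ (R : Rel₃) {a a′ b b′ c c′} → a ≡ a′ → b ≡ b′ → c ≡ c′ → R a b c → R a′ b′ c′
subst₃ R refl refl refl r = r

-- One-line positions run over 1, …, n, cycle-form indices over the times 0, …, n − 1.
Avoids₄ : Rel₄ → ℕ → (ℕ → ℕ) → Set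
Avoids₄ R n P = ∀ i j k l → 1 ≤ i → i < j → j < k → k < l → l ≤ n → ¬ R (P i) (P j) (P k) (P l)

Avoids₃ : Rel₃ → ℕ → (ℕ → ℕ) → Set
Avoids₃ R n T = ∀ i j k → i < j → j < k → k < n → ¬ R (T i) (T j) (T k)

record CyclicAvoider (R₄ : Rel₄) (R₃ : Rel₃) (n : ℕ) (P : ℕ → ℕ) : Set where
  field
    into : MapsInto n P
    injective : InjectiveOn n P
    cyclic : Cyclic n P
    avoids₄ : Avoids₄ R₄ n P
    avoids₃ : Avoids₃ R₃ n (orbit P)

Agree : ℕ → (ℕ → ℕ) → (ℕ → ℕ) → Set
Agree n P Q = ∀ i → 1 ≤ i → i ≤ n → P i ≡ Q i

orbit-agree : ∀ {n P Q} → 1 ≤ n → MapsInto n P → Agree n P Q → ∀ t → orbit P t ≡ orbit Q t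
orbit-agree 1≤n into P≗Q zero = refl
orbit-agree {Q = Q} 1≤n into P≗Q (suc t) with orbit-within 1≤n into t
... | 1≤x , x≤n = trans (P≗Q _ 1≤x x≤n) (cong Q (orbit-agree 1≤n into P≗Q t))

avoids₄-agree : ∀ {R n P Q} → Agree n P Q → Avoids₄ R n P → Avoids₄ R n Q
avoids₄-agree {R} {n} {P} {Q} P≗Q avoid i j k l 1≤i i<j j<k k<l l≤n =
  avoid i j k l 1≤i i<j j<k k<l l≤n ∘ subst₄ R (sym (at i 1≤i (<⇒≤ (<-trans i<j (<-trans j<k k<l)))))
    (sym (at j 1≤j (<⇒≤ (<-trans j<k k<l)))) (sym (at k 1≤k (<⇒≤ k<l))) (sym (at l 1≤l ≤-refl))
  where
  at : ∀ x → 1 ≤ x → x ≤ l → P x ≡ Q x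
  at x 1≤x x≤l = P≗Q x 1≤x (≤-trans x≤l l≤n)
  1≤j = ≤-trans 1≤i (<⇒≤ i<j)
  1≤k = ≤-trans 1≤j (<⇒≤ j<k)
  1≤l = ≤-trans 1≤k (<⇒≤ k<l)

module _ {R₄ : Rel₄} {R₃ : Rel₃} {n : ℕ} {P Q : ℕ → ℕ} where

  CyclicAvoider-agree : 1 ≤ n → CyclicAvoider R₄ R₃ n P → Agree n P Q → CyclicAvoider R₄ R₃ n Q
  CyclicAvoider-agree 1≤n v P≗Q = record
    { into = λ i a b → subst (Within n) (P≗Q i a b) (into i a b)
    ; injective = λ i j a b a′ b′ e → injective i j a b a′ b′ (trans (P≗Q i a b) (trans e (sym (P≗Q j a′ b′))))
    ; cyclic = λ i j i<n j<n e → cyclic i j i<n j<n (trans (same i) (trans e (sym (same j))))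
    ; avoids₄ = avoids₄-agree {R₄} P≗Q avoids₄
    ; avoids₃ = λ i j k i<j j<k k<n → avoids₃ i j k i<j j<k k<n ∘ subst₃ R₃ (sym (same i)) (sym (same j)) (sym (same k))
    }
    where
    open CyclicAvoider v
    same : ∀ t → orbit P t ≡ orbit Q t
    same = orbit-agree 1≤n into P≗Q

-- Four values form 3421 or 4321 iff the first two exceed the third, which exceeds the last;
-- they form 4312 or 4321 iff each of the last two is below the second, which is below the first.
Occ3421∪4321 Occ4312∪4321 : Rel₄
Occ3421∪4321 a b c d = c < a × c < b × d < c
Occ4312∪4321 a b c d = b < a × c < b × d < b

Occ213 Occ312 : Rel₃
Occ213 a b c = b < a × a < c
Occ312 a b c = b < c × c < a

Avoider₁ Avoider₂ : ℕ → (ℕ → ℕ) → Set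
Avoider₁ = CyclicAvoider Occ3421∪4321 Occ213
Avoider₂ = CyclicAvoider Occ4312∪4321 Occ312

StrictlyMonotone : (ℕ → ℕ) → Set
StrictlyMonotone f = ∀ {a b} → a < b → f a < f b

module _ {f : ℕ → ℕ} (mono : StrictlyMonotone f) where

  monotone-≤ : ∀ {a b} → a ≤ b → f a ≤ f b
  monotone-≤ a≤b with m≤n⇒m<n∨m≡n a≤b
  ... | inj₁ a<b = <⇒≤ (mono a<b)
  ... | inj₂ refl = ≤-refl

  monotone-reflects-< : ∀ {a b} → f a < f b → a < b
  monotone-reflects-< {a} {b} fa<fb with <-cmp a b
  ... | tri< a<b _ _ = a<b
  ... | tri≈ _ refl _ = ⊥-elim (<-irrefl refl fa<fb)
  ... | tri> _ _ b<a = ⊥-elim (<-asym fa<fb (mono b<a))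

  monotone-injective : ∀ {a b} → f a ≡ f b → a ≡ b
  monotone-injective {a} {b} fa≡fb with <-cmp a b
  ... | tri< a<b _ _ = ⊥-elim (<-irrefl fa≡fb (mono a<b))
  ... | tri≈ _ a≡b _ = a≡b
  ... | tri> _ _ b<a = ⊥-elim (<-irrefl (sym fa≡fb) (mono b<a))

Invariant₄ : Rel₄ → Set
Invariant₄ R = ∀ {f} → StrictlyMonotone f → ∀ {a b c d} → R a b c d ⇔ R (f a) (f b) (f c) (f d)

Invariant₃ : Rel₃ → Set
Invariant₃ R = ∀ {f} → StrictlyMonotone f → ∀ {a b c} → R a b c ⇔ R (f a) (f b) (f c)

invariant-3421∪4321 : Invariant₄ Occ3421∪4321
invariant-3421∪4321 mono = mk⇔ (λ (x , y , z) → mono x , mono y , mono z)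
  (λ (x , y , z) → monotone-reflects-< mono x , monotone-reflects-< mono y , monotone-reflects-< mono z)

invariant-213 : Invariant₃ Occ213
invariant-213 mono = mk⇔ (λ (x , y) → mono x , mono y) (λ (x , y) → monotone-reflects-< mono x , monotone-reflects-< mono y)

avoids₄-pullback : ∀ {R n m P S} (pos v : ℕ → ℕ) → Invariant₄ R → StrictlyMonotone pos → StrictlyMonotone v →
  1 ≤ pos 1 → pos m ≤ n → (∀ i → 1 ≤ i → i ≤ m → P (pos i) ≡ v (S i)) → Avoids₄ R n P → Avoids₄ R m S
avoids₄-pullback {R} {n} {m} {P} {S} pos v inv pos-mono v-mono 1≤pos1 posm≤n P∘pos≡v∘S avoid i j k l 1≤i i<j j<k k<l l≤m =
  avoid (pos i) (pos j) (pos k) (pos l) (≤-trans 1≤pos1 (monotone-≤ pos-mono 1≤i)) (pos-mono i<j) (pos-mono j<k) (pos-mono k<l)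
        (≤-trans (monotone-≤ pos-mono l≤m) posm≤n)
  ∘ subst₄ R (at i 1≤i (<⇒≤ (<-trans i<j (<-trans j<k k<l)))) (at j 1≤j (<⇒≤ (<-trans j<k k<l))) (at k 1≤k (<⇒≤ k<l)) (at l 1≤l ≤-refl)
  ∘ Equivalence.to (inv v-mono)
  where
  at : ∀ x → 1 ≤ x → x ≤ l → v (S x) ≡ P (pos x)
  at x 1≤x x≤l = sym (P∘pos≡v∘S x 1≤x (≤-trans x≤l l≤m))
  1≤j = ≤-trans 1≤i (<⇒≤ i<j)
  1≤k = ≤-trans 1≤j (<⇒≤ j<k)
  1≤l = ≤-trans 1≤k (<⇒≤ k<l)

-- Time 0 never starts an occurrence, since orbit S 0 = 1 cannot exceed the second entry.
avoids₃-pullback : ∀ {R n m P S} (τ v : ℕ → ℕ) → Invariant₃ R → (∀ {a b c} → R a b c → b < a) →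
  StrictlyMonotone τ → StrictlyMonotone v → (∀ t → 1 ≤ orbit S t) → (∀ t → 1 ≤ t → t < m → τ t < n) →
  (∀ t → 1 ≤ t → t < m → orbit P (τ t) ≡ v (orbit S t)) → Avoids₃ R n (orbit P) → Avoids₃ R m (orbit S)
avoids₃-pullback τ v inv second<first τ-mono v-mono orbit≥1 τ-bound at avoid zero j k i<j j<k k<m occ =
  <⇒≱ (second<first occ) (orbit≥1 j)
avoids₃-pullback {R} τ v inv second<first τ-mono v-mono orbit≥1 τ-bound at avoid (suc i) j k i<j j<k k<m =
  avoid (τ (suc i)) (τ j) (τ k) (τ-mono i<j) (τ-mono j<k) (τ-bound k 1≤k k<m)
  ∘ subst₃ R (sym (at (suc i) (s≤s z≤n) (<-trans i<j (<-trans j<k k<m)))) (sym (at j 1≤j (<-trans j<k k<m))) (sym (at k 1≤k k<m))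
  ∘ Equivalence.to (inv v-mono)
  where
  1≤j = ≤-trans (s≤s z≤n) i<j
  1≤k = ≤-trans 1≤j (<⇒≤ j<k)

-- Appending an increasing run to the cycle form, and inserting 2 after 1

runLift runPos : ℕ → ℕ → ℕ
runLift c zero = zero
runLift c (suc zero) = 2
runLift c (suc (suc v)) = 3 + c + v
runPos c zero = zero
runPos c (suc zero) = 1
runPos c (suc (suc r)) = 3 + c + r

runLift-mono : ∀ c → StrictlyMonotone (runLift c)
runLift-mono c {zero} {suc zero} _ = s≤s z≤n
runLift-mono c {suc zero} {suc zero} (s≤s ())
runLift-mono c {zero} {suc (suc b)} _ = s≤s z≤n
runLift-mono c {suc zero} {suc (suc b)} _ = s≤s (s≤s (s≤s z≤n))
runLift-mono c {suc (suc a)} {suc (suc b)} (s≤s (s≤s a<b)) = +-monoʳ-< (3 + c) a<b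

runPos-mono : ∀ c → StrictlyMonotone (runPos c)
runPos-mono c {zero} {suc zero} _ = s≤s z≤n
runPos-mono c {suc zero} {suc zero} (s≤s ())
runPos-mono c {zero} {suc (suc b)} _ = s≤s z≤n
runPos-mono c {suc zero} {suc (suc b)} _ = s≤s (s≤s z≤n)
runPos-mono c {suc (suc a)} {suc (suc b)} (s≤s (s≤s a<b)) = +-monoʳ-< (3 + c) a<b

runLift≢1 : ∀ c v → runLift c v ≢ 1
runLift≢1 c (suc (suc v)) ()

runLift≢run : ∀ c v j → j < c → runLift c v ≢ 3 + j
runLift≢run c (suc (suc v)) j j<c e = <-irrefl (sym (+-cancelˡ-≡ 3 (c + v) j e)) (<-≤-trans j<c (m≤m+n c v))

runLift-gap : ∀ c u u′ → 1 ≤ u → runLift c u < runLift c u′ → 3 + c ≤ runLift c u′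
runLift-gap c (suc zero) (suc zero) _ (s≤s (s≤s ()))
runLift-gap c (suc (suc u)) (suc zero) _ (s≤s (s≤s ()))
runLift-gap c _ (suc (suc u′)) _ _ = m≤m+n (3 + c) u′

runLift≥3+c : ∀ c u → 2 ≤ u → 3 + c ≤ runLift c u
runLift≥3+c c (suc zero) (s≤s ())
runLift≥3+c c (suc (suc u)) _ = m≤m+n (3 + c) u

-- Cycle form of appendRun c S: 1, the rest of the cycle form of S with every entry v raised to v + c + 1, then 2, 3, …, c + 2.
appendRun : ℕ → (ℕ → ℕ) → ℕ → ℕ
appendRun c S zero = zero
appendRun c S (suc zero) = runLift c (S 1)
appendRun c S (suc (suc i)) with <-cmp i c
... | tri< _ _ _ = 3 + i
... | tri≈ _ _ _ = 1
... | tri> _ _ _ = runLift c (S (suc (i ∸ c)))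

data RunPosition (c m′ : ℕ) : ℕ → Set where
  first : RunPosition c m′ 1
  run : ∀ j → j < c → RunPosition c m′ (2 + j)
  end : RunPosition c m′ (2 + c)
  lifted : ∀ r → r ≤ m′ → RunPosition c m′ (3 + c + r)

runPosition : ∀ c m′ i → 1 ≤ i → i ≤ 3 + c + m′ → RunPosition c m′ i
runPosition c m′ (suc zero) _ _ = first
runPosition c m′ (suc (suc j)) _ j+2≤n with <-cmp j c
... | tri< j<c _ _ = run j j<c
... | tri≈ _ refl _ = end
... | tri> _ _ c<j = subst (RunPosition c m′) (cong (2 +_) (m+[n∸m]≡n c<j)) (lifted (j ∸ suc c) r≤m′)
  where
  r≤m′ : j ∸ suc c ≤ m′
  r≤m′ = +-cancelˡ-≤ (suc c) _ _ (subst (_≤ suc c + m′) (sym (m+[n∸m]≡n c<j)) (≤-pred (≤-pred j+2≤n)))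

runPosition≥1 : ∀ {c m′ i} → RunPosition c m′ i → 1 ≤ i
runPosition≥1 first = ≤-refl
runPosition≥1 (run _ _) = s≤s z≤n
runPosition≥1 end = s≤s z≤n
runPosition≥1 (lifted _ _) = s≤s z≤n

module _ (c : ℕ) (S : ℕ → ℕ) where

  appendRun-run : ∀ j → j < c → appendRun c S (2 + j) ≡ 3 + j
  appendRun-run j j<c with <-cmp j c
  ... | tri< _ _ _ = refl
  ... | tri≈ j≮c _ _ = ⊥-elim (j≮c j<c)
  ... | tri> j≮c _ _ = ⊥-elim (j≮c j<c)

  appendRun-end : appendRun c S (2 + c) ≡ 1
  appendRun-end with <-cmp c c
  ... | tri< _ c≢c _ = ⊥-elim (c≢c refl)
  ... | tri≈ _ _ _ = refl
  ... | tri> _ c≢c _ = ⊥-elim (c≢c refl)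

  appendRun-lifted : ∀ r → appendRun c S (3 + c + r) ≡ runLift c (S (2 + r))
  appendRun-lifted r with <-cmp (suc (c + r)) c
  ... | tri< 1+c+r<c _ _ = ⊥-elim (<-asym 1+c+r<c (s≤s (m≤m+n c r)))
  ... | tri≈ _ 1+c+r≡c _ = ⊥-elim (<-irrefl (sym 1+c+r≡c) (s≤s (m≤m+n c r)))
  ... | tri> _ _ _ = cong (runLift c ∘ S ∘ suc) (trans (cong (_∸ c) (sym (+-suc c r))) (m+n∸m≡n c (suc r)))

  appendRun-runPos : ∀ i → 1 ≤ i → appendRun c S (runPos c i) ≡ runLift c (S i)
  appendRun-runPos (suc zero) _ = refl
  appendRun-runPos (suc (suc r)) _ = appendRun-lifted r

  valueAt : ∀ {m′ i} → RunPosition c m′ i → ℕ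
  valueAt first = runLift c (S 1)
  valueAt (run j _) = 3 + j
  valueAt end = 1
  valueAt (lifted r _) = runLift c (S (2 + r))

  appendRun-at : ∀ {m′ i} (p : RunPosition c m′ i) → appendRun c S i ≡ valueAt p
  appendRun-at first = refl
  appendRun-at (run j j<c) = appendRun-run j j<c
  appendRun-at end = appendRun-end
  appendRun-at (lifted r _) = appendRun-lifted r

split-at : ∀ t m → t < m ⊎ ∃[ d ] t ≡ d + m
split-at t m with <-cmp t m
... | tri< t<m _ _ = inj₁ t<m
... | tri≈ _ refl _ = inj₂ (0 , refl)
... | tri> _ _ m<t = inj₂ (t ∸ m , sym (m∸n+n≡m (<⇒≤ m<t)))

run-offset-bound : ∀ d c m′ → d + (2 + m′) < 3 + c + m′ → d ≤ c
run-offset-bound d c m′ lt = +-cancelʳ-≤ m′ d c (≤-pred (≤-pred (≤-pred (subst (_< 3 + c + m′) eq lt))))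
  where
  eq : d + (2 + m′) ≡ 2 + (d + m′)
  eq = trans (+-suc d (suc m′)) (cong suc (+-suc d m′))

module AppendRun (c m′ : ℕ) (S : ℕ → ℕ) where

  P : ℕ → ℕ
  P = appendRun c S

  m n : ℕ
  m = 2 + m′
  n = 3 + c + m′

  runLift-within : ∀ v → Within m v → Within n (runLift c v)
  runLift-within (suc zero) _ = s≤s z≤n , s≤s (s≤s z≤n)
  runLift-within (suc (suc v)) (_ , v+2≤m) = s≤s z≤n , +-monoʳ-≤ (3 + c) (≤-pred (≤-pred v+2≤m))

  runLift-within⁻ : ∀ v → Within n (runLift c v) → Within m v
  runLift-within⁻ (suc zero) _ = ≤-refl , s≤s z≤n
  runLift-within⁻ (suc (suc v)) (_ , lifted≤n) = s≤s z≤n , s≤s (s≤s (+-cancelˡ-≤ (3 + c) _ _ lifted≤n))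

  runPos-within : ∀ i → Within m i → Within n (runPos c i)
  runPos-within (suc zero) _ = ≤-refl , s≤s z≤n
  runPos-within (suc (suc r)) (_ , r+2≤m) = s≤s z≤n , +-monoʳ-≤ (3 + c) (≤-pred (≤-pred r+2≤m))

  module _ (intoS : MapsInto m S) where

    valueAt-within : ∀ {i} (p : RunPosition c m′ i) → Within n (valueAt c S p)
    valueAt-within first = runLift-within (S 1) (intoS 1 ≤-refl (s≤s z≤n))
    valueAt-within (run j j<c) = s≤s z≤n , s≤s (s≤s (≤-trans j<c (≤-trans (n≤1+n c) (m≤m+n (suc c) m′))))
    valueAt-within end = ≤-refl , s≤s z≤n
    valueAt-within (lifted r r≤m′) = runLift-within _ (intoS (2 + r) (s≤s z≤n) (s≤s (s≤s r≤m′)))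

    into : MapsInto n P
    into i 1≤i i≤n = subst (Within n) (sym (appendRun-at c S p)) (valueAt-within p)
      where
      p : RunPosition c m′ i
      p = runPosition c m′ i 1≤i i≤n

    injective : InjectiveOn m S → InjectiveOn n P
    injective injS i j 1≤i i≤n 1≤j j≤n e =
      distinct p q (trans (sym (appendRun-at c S p)) (trans e (appendRun-at c S q)))
      where
      p : RunPosition c m′ i
      p = runPosition c m′ i 1≤i i≤n
      q : RunPosition c m′ j
      q = runPosition c m′ j 1≤j j≤n
      source-injective : ∀ {x y} → 1 ≤ x → x ≤ m → 1 ≤ y → y ≤ m → runLift c (S x) ≡ runLift c (S y) → x ≡ y
      source-injective 1≤x x≤m 1≤y y≤m e = injS _ _ 1≤x x≤m 1≤y y≤m (monotone-injective (runLift-mono c) e)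
      distinct : ∀ {i j} (p : RunPosition c m′ i) (q : RunPosition c m′ j) → valueAt c S p ≡ valueAt c S q → i ≡ j
      distinct first first _ = refl
      distinct first (run j j<c) e = ⊥-elim (runLift≢run c (S 1) j j<c e)
      distinct first end e = ⊥-elim (runLift≢1 c (S 1) e)
      distinct first (lifted r r≤m′) e with source-injective ≤-refl (s≤s z≤n) (s≤s z≤n) (s≤s (s≤s r≤m′)) e
      ... | ()
      distinct (run j j<c) first e = ⊥-elim (runLift≢run c (S 1) j j<c (sym e))
      distinct (run j _) (run k _) e = cong (2 +_) (+-cancelˡ-≡ 3 j k e)
      distinct (run _ _) end ()
      distinct (run j j<c) (lifted r _) e = ⊥-elim (runLift≢run c (S (2 + r)) j j<c (sym e))
      distinct end first e = ⊥-elim (runLift≢1 c (S 1) (sym e))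
      distinct end (run _ _) ()
      distinct end end _ = refl
      distinct end (lifted r _) e = ⊥-elim (runLift≢1 c (S (2 + r)) (sym e))
      distinct (lifted r r≤m′) first e with source-injective (s≤s z≤n) (s≤s (s≤s r≤m′)) ≤-refl (s≤s z≤n) e
      ... | ()
      distinct (lifted r _) (run j j<c) e = ⊥-elim (runLift≢run c (S (2 + r)) j j<c e)
      distinct (lifted r _) end e = ⊥-elim (runLift≢1 c (S (2 + r)) e)
      distinct (lifted r r≤m′) (lifted s s≤m′) e =
        cong (3 + c +_) (+-cancelˡ-≡ 2 r s (source-injective (s≤s z≤n) (s≤s (s≤s r≤m′)) (s≤s z≤n) (s≤s (s≤s s≤m′)) e))

  step-lifted : ∀ u → 2 ≤ u → P (runLift c u) ≡ runLift c (S u)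
  step-lifted (suc zero) (s≤s ())
  step-lifted (suc (suc v)) _ = appendRun-lifted c S v

  orbit-lifted-before-return : ∀ t → 1 ≤ t → (∀ t′ → 1 ≤ t′ → t′ < t → 2 ≤ orbit S t′) → orbit P t ≡ runLift c (orbit S t)
  orbit-lifted-before-return (suc zero) _ _ = refl
  orbit-lifted-before-return (suc (suc t)) _ earlier =
    trans (cong P (orbit-lifted-before-return (suc t) (s≤s z≤n) λ t′ 1≤t′ t′<1+t → earlier t′ 1≤t′ (m<n⇒m<1+n t′<1+t)))
          (step-lifted (orbit S (suc t)) (earlier (suc t) (s≤s z≤n) ≤-refl))

  orbit-run : ∀ s → orbit P s ≡ 2 → ∀ d → d ≤ c → orbit P (d + s) ≡ 2 + d
  orbit-run s e zero _ = e
  orbit-run s e (suc d) 1+d≤c = trans (cong P (orbit-run s e d (<⇒≤ 1+d≤c))) (appendRun-run c S d 1+d≤c)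

  orbit-run-end : ∀ s → orbit P s ≡ 2 → orbit P (suc c + s) ≡ 1
  orbit-run-end s e = trans (cong P (orbit-run s e c ≤-refl)) (appendRun-end c S)

  module _ (intoS : MapsInto m S) (injS : InjectiveOn m S) (cycS : Cyclic m S) where

    orbit-lifted : ∀ t → 1 ≤ t → t < m → orbit P t ≡ runLift c (orbit S t)
    orbit-lifted t 1≤t t<m = orbit-lifted-before-return t 1≤t λ t′ 1≤t′ t′<t → orbit≥2 (s≤s z≤n) intoS injS cycS t′ 1≤t′ (<-trans t′<t t<m)

    orbit-at-m : orbit P m ≡ 2
    orbit-at-m = begin
      P (orbit P (suc m′))                   ≡⟨ cong P (orbit-lifted (suc m′) (s≤s z≤n) ≤-refl) ⟩
      P (runLift c (orbit S (suc m′)))       ≡⟨ step-lifted _ (orbit≥2 (s≤s z≤n) intoS injS cycS (suc m′) (s≤s z≤n) ≤-refl) ⟩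
      runLift c (orbit S m)                  ≡⟨ cong (runLift c) (orbit-period (s≤s z≤n) intoS injS cycS) ⟩
      2                                      ∎
      where open ≡-Reasoning

    orbit-after : ∀ d → d ≤ c → orbit P (d + m) ≡ 2 + d
    orbit-after = orbit-run m orbit-at-m

    cyclic : Cyclic n P
    cyclic = cyclic-if-no-early-return (s≤s z≤n) (into intoS) (injective intoS injS) returns-late
      where
      returns-late : ∀ t → 1 ≤ t → t < n → 2 ≤ orbit P t
      returns-late t 1≤t t<n with split-at t m
      ... | inj₁ t<m = subst (2 ≤_) (sym (orbit-lifted t 1≤t t<m))
                         (≤-trans (s≤s (s≤s z≤n)) (monotone-≤ (runLift-mono c) (orbit≥2 (s≤s z≤n) intoS injS cycS t 1≤t t<m)))
      ... | inj₂ (d , refl) = subst (2 ≤_) (sym (orbit-after d (run-offset-bound d c m′ t<n))) (m≤m+n 2 d)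

  module _ (intoP : MapsInto n P) (injP : InjectiveOn n P) where

    into⁻ : MapsInto m S
    into⁻ i 1≤i i≤m = runLift-within⁻ (S i) (subst (Within n) (appendRun-runPos c S i 1≤i) (intoP (runPos c i) (proj₁ pos) (proj₂ pos)))
      where
      pos : Within n (runPos c i)
      pos = runPos-within i (1≤i , i≤m)

    injective⁻ : InjectiveOn m S
    injective⁻ i j 1≤i i≤m 1≤j j≤m e = monotone-injective (runPos-mono c)
      (injP (runPos c i) (runPos c j) (proj₁ (runPos-within i (1≤i , i≤m))) (proj₂ (runPos-within i (1≤i , i≤m)))
                                      (proj₁ (runPos-within j (1≤j , j≤m))) (proj₂ (runPos-within j (1≤j , j≤m)))
        (trans (appendRun-runPos c S i 1≤i) (trans (cong (runLift c) e) (sym (appendRun-runPos c S j 1≤j)))))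

    cyclic⁻ : Cyclic n P → Cyclic m S
    cyclic⁻ cycP = cyclic-if-no-early-return (s≤s z≤n) into⁻ injective⁻ (no-early-return returns-late)
      where
      shifted< : ∀ t → t < m → suc c + t < n
      shifted< t t<m = subst (suc c + t <_) (cong suc (trans (+-suc c (suc m′)) (cong suc (+-suc c m′)))) (+-monoʳ-< (suc c) t<m)
      returns-late : ∀ t → 1 ≤ t → t < m → (∀ t′ → 1 ≤ t′ → t′ < t → 2 ≤ orbit S t′) → 2 ≤ orbit S t
      returns-late t 1≤t t<m earlier = ≤∧≢⇒< (proj₁ (orbit-within (s≤s z≤n) into⁻ t)) λ 1≡St →
        2≰1 (subst (2 ≤_) (orbit-run-end t (trans (orbit-lifted-before-return t 1≤t earlier) (cong (runLift c) (sym 1≡St))))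
                         (orbit≥2 (s≤s z≤n) intoP injP cycP (suc c + t) (s≤s z≤n) (shifted< t t<m)))

twoLift : ℕ → ℕ
twoLift zero = zero
twoLift (suc zero) = 1
twoLift (suc (suc v)) = 3 + v

twoLift-mono : StrictlyMonotone twoLift
twoLift-mono {zero} {suc zero} _ = s≤s z≤n
twoLift-mono {suc zero} {suc zero} (s≤s ())
twoLift-mono {zero} {suc (suc b)} _ = s≤s z≤n
twoLift-mono {suc zero} {suc (suc b)} _ = s≤s (s≤s z≤n)
twoLift-mono {suc (suc a)} {suc (suc b)} (s≤s a+1<b+1) = s≤s (s≤s a+1<b+1)

twoLift≢2 : ∀ v → twoLift v ≢ 2
twoLift≢2 zero ()
twoLift≢2 (suc zero) ()
twoLift≢2 (suc (suc v)) ()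

-- Cycle form of insertTwo S: 1, 2, then the rest of the cycle form of S with every entry v raised to v + 1.
insertTwo : (ℕ → ℕ) → ℕ → ℕ
insertTwo S zero = zero
insertTwo S (suc zero) = 2
insertTwo S (suc (suc i)) = twoLift (S (suc i))

module InsertTwo (m′ : ℕ) (S : ℕ → ℕ) where

  P : ℕ → ℕ
  P = insertTwo S

  m n : ℕ
  m = 2 + m′
  n = 3 + m′

  twoLift-within : ∀ v → Within m v → Within n (twoLift v)
  twoLift-within (suc zero) _ = ≤-refl , s≤s z≤n
  twoLift-within (suc (suc v)) (_ , v+2≤m) = s≤s z≤n , s≤s v+2≤m

  twoLift-within⁻ : ∀ v → Within n (twoLift v) → Within m v
  twoLift-within⁻ (suc zero) _ = ≤-refl , s≤s z≤n
  twoLift-within⁻ (suc (suc v)) (_ , s≤s v+2≤m) = s≤s z≤n , v+2≤m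

  into : MapsInto m S → MapsInto n P
  into intoS (suc zero) _ _ = s≤s z≤n , s≤s (s≤s z≤n)
  into intoS (suc (suc i)) _ (s≤s i+1≤m) = twoLift-within (S (suc i)) (intoS (suc i) (s≤s z≤n) i+1≤m)

  injective : InjectiveOn m S → InjectiveOn n P
  injective injS (suc zero) (suc zero) _ _ _ _ _ = refl
  injective injS (suc zero) (suc (suc j)) _ _ _ _ e = ⊥-elim (twoLift≢2 (S (suc j)) (sym e))
  injective injS (suc (suc i)) (suc zero) _ _ _ _ e = ⊥-elim (twoLift≢2 (S (suc i)) e)
  injective injS (suc (suc i)) (suc (suc j)) _ (s≤s i+1≤m) _ (s≤s j+1≤m) e =
    cong suc (injS (suc i) (suc j) (s≤s z≤n) i+1≤m (s≤s z≤n) j+1≤m (monotone-injective twoLift-mono e))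

  step-lifted : ∀ u → 2 ≤ u → P (twoLift u) ≡ twoLift (S u)
  step-lifted (suc zero) (s≤s ())
  step-lifted (suc (suc v)) _ = refl

  orbit-lifted-before-return : ∀ t → 1 ≤ t → (∀ t′ → 1 ≤ t′ → t′ < t → 2 ≤ orbit S t′) → orbit P (suc t) ≡ twoLift (orbit S t)
  orbit-lifted-before-return (suc zero) _ _ = refl
  orbit-lifted-before-return (suc (suc t)) _ earlier =
    trans (cong P (orbit-lifted-before-return (suc t) (s≤s z≤n) λ t′ 1≤t′ t′<1+t → earlier t′ 1≤t′ (m<n⇒m<1+n t′<1+t)))
          (step-lifted (orbit S (suc t)) (earlier (suc t) (s≤s z≤n) ≤-refl))

  module _ (intoS : MapsInto m S) (injS : InjectiveOn m S) (cycS : Cyclic m S) where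

    orbit-lifted : ∀ t → 1 ≤ t → t < m → orbit P (suc t) ≡ twoLift (orbit S t)
    orbit-lifted t 1≤t t<m = orbit-lifted-before-return t 1≤t λ t′ 1≤t′ t′<t → orbit≥2 (s≤s z≤n) intoS injS cycS t′ 1≤t′ (<-trans t′<t t<m)

    cyclic : Cyclic n P
    cyclic = cyclic-if-no-early-return (s≤s z≤n) (into intoS) (injective injS) returns-late
      where
      returns-late : ∀ t → 1 ≤ t → t < n → 2 ≤ orbit P t
      returns-late (suc zero) _ _ = ≤-refl
      returns-late (suc (suc t)) _ (s≤s t+1<m) = subst (2 ≤_) (sym (orbit-lifted (suc t) (s≤s z≤n) t+1<m))
        (≤-trans (s≤s (s≤s z≤n)) (monotone-≤ twoLift-mono (orbit≥2 (s≤s z≤n) intoS injS cycS (suc t) (s≤s z≤n) t+1<m)))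

  module _ (intoP : MapsInto n P) (injP : InjectiveOn n P) where

    into⁻ : MapsInto m S
    into⁻ (suc i) _ i+1≤m = twoLift-within⁻ (S (suc i)) (intoP (suc (suc i)) (s≤s z≤n) (s≤s i+1≤m))

    injective⁻ : InjectiveOn m S
    injective⁻ (suc i) (suc j) _ i+1≤m _ j+1≤m e = suc-injective (injP (suc (suc i)) (suc (suc j)) (s≤s z≤n) (s≤s i+1≤m) (s≤s z≤n) (s≤s j+1≤m) (cong twoLift e))

    cyclic⁻ : Cyclic n P → Cyclic m S
    cyclic⁻ cycP = cyclic-if-no-early-return (s≤s z≤n) into⁻ injective⁻ (no-early-return returns-late)
      where
      returns-late : ∀ t → 1 ≤ t → t < m → (∀ t′ → 1 ≤ t′ → t′ < t → 2 ≤ orbit S t′) → 2 ≤ orbit S t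
      returns-late t 1≤t t<m earlier = ≤∧≢⇒< (proj₁ (orbit-within (s≤s z≤n) into⁻ t)) λ 1≡St →
        2≰1 (subst (2 ≤_) (trans (orbit-lifted-before-return t 1≤t earlier) (cong twoLift (sym 1≡St)))
                         (orbit≥2 (s≤s z≤n) intoP injP cycP (suc t) (s≤s z≤n) (s≤s t<m)))

module _ {R₄ : Rel₄} {R₃ : Rel₃} (inv₄ : Invariant₄ R₄) (inv₃ : Invariant₃ R₃) (second<first : ∀ {a b c} → R₃ a b c → b < a) where

  appendRun-pullback : ∀ c m′ S → CyclicAvoider R₄ R₃ (3 + c + m′) (appendRun c S) → CyclicAvoider R₄ R₃ (2 + m′) S
  appendRun-pullback c m′ S v = record
    { into = intoS
    ; injective = injS
    ; cyclic = cycS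
    ; avoids₄ = avoids₄-pullback (runPos c) (runLift c) inv₄ (runPos-mono c) (runLift-mono c) ≤-refl ≤-refl
                  (λ i 1≤i _ → appendRun-runPos c S i 1≤i) V.avoids₄
    ; avoids₃ = avoids₃-pullback id (runLift c) inv₃ second<first id (runLift-mono c)
                  (λ t → proj₁ (orbit-within (s≤s z≤n) intoS t)) (λ t _ t<m → <-≤-trans t<m (s≤s (s≤s (m≤n⇒m≤1+n (m≤n+m m′ c)))))
                  (A.orbit-lifted intoS injS cycS) V.avoids₃
    }
    where
    module V = CyclicAvoider v
    module A = AppendRun c m′ S
    intoS : MapsInto (2 + m′) S
    intoS = A.into⁻ V.into V.injective
    injS : InjectiveOn (2 + m′) S
    injS = A.injective⁻ V.into V.injective
    cycS : Cyclic (2 + m′) S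
    cycS = A.cyclic⁻ V.into V.injective V.cyclic

  insertTwo-pullback : ∀ m′ S → CyclicAvoider R₄ R₃ (3 + m′) (insertTwo S) → CyclicAvoider R₄ R₃ (2 + m′) S
  insertTwo-pullback m′ S v = record
    { into = intoS
    ; injective = injS
    ; cyclic = cycS
    ; avoids₄ = avoids₄-pullback suc twoLift inv₄ s≤s twoLift-mono (s≤s z≤n) ≤-refl shifted V.avoids₄
    ; avoids₃ = avoids₃-pullback suc twoLift inv₃ second<first s≤s twoLift-mono
                  (λ t → proj₁ (orbit-within (s≤s z≤n) intoS t)) (λ t _ t<m → s≤s t<m)
                  (I.orbit-lifted intoS injS cycS) V.avoids₃
    }
    where
    module V = CyclicAvoider v
    module I = InsertTwo m′ S
    intoS : MapsInto (2 + m′) S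
    intoS = I.into⁻ V.into V.injective
    injS : InjectiveOn (2 + m′) S
    injS = I.injective⁻ V.into V.injective
    cycS : Cyclic (2 + m′) S
    cycS = I.cyclic⁻ V.into V.injective V.cyclic
    shifted : ∀ i → 1 ≤ i → i ≤ 2 + m′ → insertTwo S (suc i) ≡ twoLift (S i)
    shifted (suc i) _ _ = refl

-- The first family under both insertions, and its decomposition

module _ (c m′ : ℕ) (S : ℕ → ℕ) (avS : Avoider₁ (2 + m′) S) where
  private
    module V = CyclicAvoider avS
    open AppendRun c m′ S using (P; m; n; orbit-lifted; orbit-after)
    module A = AppendRun c m′ S
    value≥1 : ∀ {x} (X : RunPosition c m′ x) → 1 ≤ valueAt c S X
    value≥1 X = proj₁ (A.valueAt-within V.into X)
    lifted-big : ∀ {r s} → s ≤ m′ → runLift c (S (2 + s)) < runLift c (S (2 + r)) → 3 + c ≤ runLift c (S (2 + r))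
    lifted-big {r} {s} s≤m′ = runLift-gap c (S (2 + s)) (S (2 + r)) (proj₁ (V.into (2 + s) (s≤s z≤n) (s≤s (s≤s s≤m′))))
    below-run : ∀ {k x} → k < c → x < 3 + k → 3 + c ≤ x → ⊥
    below-run k<c x<3+k 3+c≤x = <⇒≱ (<-trans x<3+k (s≤s (s≤s (s≤s k<c)))) 3+c≤x
    reflect : ∀ {w x y z} → Occ3421∪4321 (runLift c w) (runLift c x) (runLift c y) (runLift c z) → Occ3421∪4321 w x y z
    reflect = Equivalence.from (invariant-3421∪4321 (runLift-mono c))

  -- The third entry can be neither in the increasing run nor the 1 ending it, so the last two entries are lifted
  -- and the third exceeds all run values; then the first two are lifted as well, or the first sits at position 1.
  appendRun-no-occurrence : ∀ {p q r s} (P′ : RunPosition c m′ p) (Q′ : RunPosition c m′ q) (R′ : RunPosition c m′ r) (S′ : RunPosition c m′ s) →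
    p < q → q < r → r < s → ¬ Occ3421∪4321 (valueAt c S P′) (valueAt c S Q′) (valueAt c S R′) (valueAt c S S′)
  appendRun-no-occurrence P′ Q′ first S′ _ q<r _ _ = <⇒≱ q<r (runPosition≥1 Q′)
  appendRun-no-occurrence P′ first (run j _) S′ p<q _ _ _ = <⇒≱ p<q (runPosition≥1 P′)
  appendRun-no-occurrence P′ (run k _) (run j _) S′ _ q<r _ (_ , b>c , _) = <-asym (+-cancelˡ-< 2 k j q<r) (+-cancelˡ-< 3 j k b>c)
  appendRun-no-occurrence P′ end (run j j<c) S′ _ q<r _ _ = <-asym (+-cancelˡ-< 2 c j q<r) j<c
  appendRun-no-occurrence P′ (lifted r _) (run j j<c) S′ _ q<r _ _ = <-asym (≤-<-trans (+-cancelˡ-≤ 2 (suc (c + r)) j (<⇒≤ q<r)) j<c) (s≤s (m≤m+n c r))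
  appendRun-no-occurrence P′ Q′ end S′ _ _ _ (_ , _ , d<1) = <⇒≱ d<1 (value≥1 S′)
  appendRun-no-occurrence P′ Q′ (lifted r _) first _ _ r<s _ = <⇒≱ r<s (s≤s z≤n)
  appendRun-no-occurrence P′ Q′ (lifted r _) (run j j<c) _ _ r<s _ = <⇒≱ r<s (s≤s (s≤s (≤-trans (<⇒≤ j<c) (≤-trans (m≤m+n c r) (n≤1+n _)))))
  appendRun-no-occurrence P′ Q′ (lifted r _) end _ _ r<s _ = <⇒≱ r<s (s≤s (s≤s (m≤n⇒m≤1+n (m≤m+n c r))))
  appendRun-no-occurrence P′ first (lifted _ _) (lifted _ _) p<q _ _ _ = <⇒≱ p<q (runPosition≥1 P′)
  appendRun-no-occurrence P′ (run k k<c) (lifted r _) (lifted s s≤m′) _ _ _ (_ , b>c , c>d) = below-run k<c b>c (lifted-big s≤m′ c>d)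
  appendRun-no-occurrence P′ end (lifted r r≤m′) (lifted _ _) _ _ _ (_ , b>c , _) = <⇒≱ b>c (value≥1 (lifted r r≤m′))
  appendRun-no-occurrence (run k k<c) (lifted _ _) (lifted r _) (lifted s s≤m′) _ _ _ (a>c , _ , c>d) = below-run k<c a>c (lifted-big s≤m′ c>d)
  appendRun-no-occurrence end (lifted _ _) (lifted r r≤m′) (lifted _ _) _ _ _ (a>c , _ , _) = <⇒≱ a>c (value≥1 (lifted r r≤m′))
  appendRun-no-occurrence first (lifted q q≤m′) (lifted r r≤m′) (lifted s s≤m′) _ q<r r<s occ =
    V.avoids₄ 1 (2 + q) (2 + r) (2 + s) ≤-refl (s≤s (s≤s z≤n)) (s≤s (s≤s (+-cancelˡ-< (3 + c) q r q<r)))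
      (s≤s (s≤s (+-cancelˡ-< (3 + c) r s r<s))) (s≤s (s≤s s≤m′)) (reflect occ)
  appendRun-no-occurrence (lifted p _) (lifted q q≤m′) (lifted r r≤m′) (lifted s s≤m′) p<q q<r r<s occ =
    V.avoids₄ (2 + p) (2 + q) (2 + r) (2 + s) (s≤s z≤n) (s≤s (s≤s (+-cancelˡ-< (3 + c) p q p<q))) (s≤s (s≤s (+-cancelˡ-< (3 + c) q r q<r)))
      (s≤s (s≤s (+-cancelˡ-< (3 + c) r s r<s))) (s≤s (s≤s s≤m′)) (reflect occ)

  appendRun-avoids₄ : Avoids₄ Occ3421∪4321 n P
  appendRun-avoids₄ p q r s 1≤p p<q q<r r<s s≤n occ =
    appendRun-no-occurrence P′ Q′ R′ S′ p<q q<r r<s (subst₄ Occ3421∪4321 (appendRun-at c S P′) (appendRun-at c S Q′) (appendRun-at c S R′) (appendRun-at c S S′) occ)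
    where
    1≤q = ≤-trans 1≤p (<⇒≤ p<q)
    1≤r = ≤-trans 1≤q (<⇒≤ q<r)
    1≤s = ≤-trans 1≤r (<⇒≤ r<s)
    at : ∀ x → 1 ≤ x → x ≤ s → RunPosition c m′ x
    at x 1≤x x≤s = runPosition c m′ x 1≤x (≤-trans x≤s s≤n)
    P′ : RunPosition c m′ p
    P′ = at p 1≤p (<⇒≤ (<-trans p<q (<-trans q<r r<s)))
    Q′ : RunPosition c m′ q
    Q′ = at q 1≤q (<⇒≤ (<-trans q<r r<s))
    R′ : RunPosition c m′ r
    R′ = at r 1≤r (<⇒≤ r<s)
    S′ : RunPosition c m′ s
    S′ = at s 1≤s ≤-refl

  appendRun-avoids₃ : Avoids₃ Occ213 n (orbit P)
  appendRun-avoids₃ zero j k _ _ _ (b<1 , _) = <⇒≱ b<1 (proj₁ (orbit-within (s≤s z≤n) (A.into V.into) j))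
  appendRun-avoids₃ (suc i) j k i<j j<k k<n occ with split-at k m
  ... | inj₁ k<m = V.avoids₃ (suc i) j k i<j j<k k<m
        (Equivalence.from (invariant-213 (runLift-mono c)) (subst₃ Occ213 (at (suc i) (s≤s z≤n) (<-trans i<j (<-trans j<k k<m)))
          (at j 1≤j (<-trans j<k k<m)) (at k (≤-trans 1≤j (<⇒≤ j<k)) k<m) occ))
    where
    1≤j = ≤-trans (s≤s z≤n) i<j
    at : ∀ t → 1 ≤ t → t < m → orbit P t ≡ runLift c (orbit S t)
    at = orbit-lifted V.into V.injective V.cyclic
  ... | inj₂ (d , refl) with split-at (suc i) m
  ...   | inj₁ i<m = <⇒≱ (proj₂ occ) (begin
      orbit P (d + m)                         ≡⟨ orbit-after V.into V.injective V.cyclic d (run-offset-bound d c m′ k<n) ⟩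
      2 + d                                   ≤⟨ s≤s (s≤s (m≤n⇒m≤1+n (run-offset-bound d c m′ k<n))) ⟩
      3 + c                                   ≤⟨ runLift≥3+c c _ (orbit≥2 (s≤s z≤n) V.into V.injective V.cyclic (suc i) (s≤s z≤n) i<m) ⟩
      runLift c (orbit S (suc i))             ≡⟨ orbit-lifted V.into V.injective V.cyclic (suc i) (s≤s z≤n) i<m ⟨
      orbit P (suc i)                         ∎)
      where open ≤-Reasoning
  ...   | inj₂ (e , 1+i≡e+m) with split-at j m
  ...     | inj₁ j<m = <⇒≱ (<-trans i<j j<m) (subst (m ≤_) (sym 1+i≡e+m) (m≤n+m m e))
  ...     | inj₂ (e′ , refl) = <-asym (proj₁ occ′) (s≤s (s≤s (+-cancelʳ-< m e e′ (subst (_< e′ + m) 1+i≡e+m i<j))))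
    where
    occ′ : Occ213 (2 + e) (2 + e′) (2 + d)
    occ′ = subst₃ Occ213 (trans (cong (orbit P) 1+i≡e+m) (orbit-after V.into V.injective V.cyclic e (run-offset-bound e c m′ (<-trans (subst (_< e′ + m) 1+i≡e+m i<j) (<-trans j<k k<n)))))
                         (orbit-after V.into V.injective V.cyclic e′ (run-offset-bound e′ c m′ (<-trans j<k k<n)))
                         (orbit-after V.into V.injective V.cyclic d (run-offset-bound d c m′ k<n)) occ

  appendRun-avoider : Avoider₁ n P
  appendRun-avoider = record
    { into = A.into V.into
    ; injective = A.injective V.into V.injective
    ; cyclic = A.cyclic V.into V.injective V.cyclic
    ; avoids₄ = appendRun-avoids₄
    ; avoids₃ = appendRun-avoids₃
    }

module _ (m′ : ℕ) (S : ℕ → ℕ) (avS : Avoider₁ (2 + m′) S) where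
  private
    module V = CyclicAvoider avS
    open InsertTwo m′ S using (P; m; n; orbit-lifted)
    module I = InsertTwo m′ S
    intoP : MapsInto n P
    intoP = I.into V.into
    injP : InjectiveOn n P
    injP = I.injective V.injective
    cycP : Cyclic n P
    cycP = I.cyclic V.into V.injective V.cyclic

  insertTwo-avoids₄ : Avoids₄ Occ3421∪4321 n P
  insertTwo-avoids₄ (suc zero) q r s _ _ q<r r<s s≤n (2>c , _ , d<c) =
    <⇒≱ (<-≤-trans d<c (≤-pred 2>c)) (proj₁ (intoP s (≤-trans (s≤s z≤n) (<-trans q<r r<s)) s≤n))
  insertTwo-avoids₄ (suc (suc p)) (suc q) (suc r) (suc s) _ (s≤s p<q) (s≤s q<r) (s≤s r<s) (s≤s s≤m) occ =
    V.avoids₄ (suc p) q r s (s≤s z≤n) p<q q<r r<s s≤m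
      (Equivalence.from (invariant-3421∪4321 twoLift-mono) (subst₄ Occ3421∪4321 (shift (suc p) (s≤s z≤n)) (shift q 1≤q) (shift r 1≤r) (shift s 1≤s) occ))
    where
    shift : ∀ x → 1 ≤ x → insertTwo S (suc x) ≡ twoLift (S x)
    shift (suc x) _ = refl
    1≤q = ≤-trans (s≤s z≤n) p<q
    1≤r = ≤-trans 1≤q (<⇒≤ q<r)
    1≤s = ≤-trans 1≤r (<⇒≤ r<s)

  insertTwo-avoids₃ : Avoids₃ Occ213 n (orbit P)
  insertTwo-avoids₃ zero j k _ _ _ (b<1 , _) = <⇒≱ b<1 (proj₁ (orbit-within (s≤s z≤n) intoP j))
  insertTwo-avoids₃ (suc zero) j k 1<j j<k k<n (b<2 , _) = <⇒≱ b<2 (orbit≥2 (s≤s z≤n) intoP injP cycP j (<⇒≤ 1<j) (<-trans j<k k<n))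
  insertTwo-avoids₃ (suc (suc i)) (suc j) (suc k) (s≤s i+1<j) (s≤s j<k) (s≤s k<m) occ =
    V.avoids₃ (suc i) j k i+1<j j<k k<m
      (Equivalence.from (invariant-213 twoLift-mono) (subst₃ Occ213 (at (suc i) (s≤s z≤n) (<-trans i+1<j (<-trans j<k k<m)))
        (at j 1≤j (<-trans j<k k<m)) (at k (≤-trans 1≤j (<⇒≤ j<k)) k<m) occ))
    where
    1≤j = ≤-trans (s≤s z≤n) i+1<j
    at : ∀ t → 1 ≤ t → t < m → orbit P (suc t) ≡ twoLift (orbit S t)
    at = orbit-lifted V.into V.injective V.cyclic

  insertTwo-avoider : Avoider₁ n P
  insertTwo-avoider = record { into = intoP ; injective = injP ; cyclic = cycP ; avoids₄ = insertTwo-avoids₄ ; avoids₃ = insertTwo-avoids₃ }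

runDrop : ℕ → ℕ → ℕ
runDrop c (suc (suc zero)) = 1
runDrop c v = v ∸ suc c

runLift-runDrop : ∀ c u → u ≡ 2 ⊎ 3 + c ≤ u → runLift c (runDrop c u) ≡ u
runLift-runDrop c _ (inj₁ refl) = refl
runLift-runDrop c u (inj₂ 3+c≤u) with u ∸ (3 + c) | m+[n∸m]≡n 3+c≤u
... | v | refl = cong (runLift c) (trans (cong (_∸ c) (sym (trans (+-suc c (suc v)) (cong suc (+-suc c v))))) (m+n∸m≡n c (2 + v)))

twoDrop : ℕ → ℕ
twoDrop (suc (suc (suc v))) = suc (suc v)
twoDrop v = v

twoLift-twoDrop : ∀ u → u ≢ 2 → twoLift (twoDrop u) ≡ u
twoLift-twoDrop zero _ = refl
twoLift-twoDrop (suc zero) _ = refl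
twoLift-twoDrop (suc (suc zero)) u≢2 = ⊥-elim (u≢2 refl)
twoLift-twoDrop (suc (suc (suc v))) _ = refl

appendRun-characterization : ∀ c m′ P → (P 1 ≡ 2 ⊎ 3 + c ≤ P 1) → (∀ j → j < c → P (2 + j) ≡ 3 + j) → P (2 + c) ≡ 1 →
  (∀ r → r ≤ m′ → P (3 + c + r) ≡ 2 ⊎ 3 + c ≤ P (3 + c + r)) → Agree (3 + c + m′) P (appendRun c (runDrop c ∘ P ∘ runPos c))
appendRun-characterization c m′ P first-ok run-ok end-ok lifted-ok i 1≤i i≤n with runPosition c m′ i 1≤i i≤n
... | first = sym (runLift-runDrop c (P 1) first-ok)
... | run j j<c = trans (run-ok j j<c) (sym (appendRun-run c _ j j<c))
... | end = trans end-ok (sym (appendRun-end c _))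
... | lifted r r≤m′ = trans (sym (runLift-runDrop c _ (lifted-ok r r≤m′))) (sym (appendRun-lifted c _ r))

insertTwo-characterization : ∀ n P → P 1 ≡ 2 → (∀ i → 2 ≤ i → i ≤ n → P i ≢ 2) → Agree n P (insertTwo (twoDrop ∘ P ∘ suc))
insertTwo-characterization n P P1≡2 others-ok (suc zero) _ _ = P1≡2
insertTwo-characterization n P P1≡2 others-ok (suc (suc i)) _ i+2≤n = sym (twoLift-twoDrop (P (2 + i)) (others-ok (2 + i) (s≤s (s≤s z≤n)) i+2≤n))

data Decomposition (n : ℕ) (P : ℕ → ℕ) : Set where
  by-insertTwo : ∀ m′ S → n ≡ 3 + m′ → Avoider₁ (2 + m′) S → Agree n P (insertTwo S) → Decomposition n P
  by-appendRun : ∀ c m′ S → n ≡ 3 + c + m′ → Avoider₁ (2 + m′) S → Agree n P (appendRun c S) → Decomposition n P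

above-all : ∀ x d → 2 ≤ x → (∀ d′ → d′ ≤ d → x ≢ 2 + d′) → 3 + d ≤ x
above-all (suc zero) d (s≤s ()) _
above-all (suc (suc x)) d _ x≢ with ≤-<-connex x d
... | inj₁ x≤d = ⊥-elim (x≢ x x≤d refl)
... | inj₂ d<x = s≤s (s≤s d<x)

two-or-above : ∀ c v → 2 ≤ v → (∀ j → j < c → v ≢ 3 + j) → v ≡ 2 ⊎ 3 + c ≤ v
two-or-above c (suc zero) (s≤s ()) _
two-or-above c (suc (suc zero)) _ _ = inj₁ refl
two-or-above c (suc (suc (suc v))) _ v≢ with ≤-<-connex c v
... | inj₁ c≤v = inj₂ (s≤s (s≤s (s≤s c≤v)))
... | inj₂ v<c = ⊥-elim (v≢ v v<c refl)

module Decompose {n : ℕ} {P : ℕ → ℕ} (avP : Avoider₁ n P) (3≤n : 3 ≤ n) where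
  private
    module V = CyclicAvoider avP
    1≤n : 1 ≤ n
    1≤n = ≤-trans (s≤s z≤n) 3≤n
    orb : ℕ → ℕ
    orb = orbit P
    orb-within : ∀ t → Within n (orb t)
    orb-within = orbit-within 1≤n V.into
    orb≥2 : ∀ t → 1 ≤ t → t < n → 2 ≤ orb t
    orb≥2 = orbit≥2 1≤n V.into V.injective V.cyclic
    covers : ∀ v → Within n v → ∃[ t ] t < n × orb t ≡ v
    covers = orbit-covers 1≤n V.into V.injective V.cyclic

  module AfterTwo (m′ : ℕ) (t₂<n : 2 + m′ < n) (orb-t₂ : orb (2 + m′) ≡ 2) where
    t₂ : ℕ
    t₂ = 2 + m′

    before-above-after : ∀ i j → 1 ≤ i → i < t₂ → t₂ < j → j < n → orb j < orb i
    before-above-after i j 1≤i i<t₂ t₂<j j<n = ≰⇒> λ orbᵢ≤orbⱼ → V.avoids₃ i t₂ j i<t₂ t₂<j j<n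
      ( subst (_< orb i) (sym orb-t₂) (≤∧≢⇒< (orb≥2 i 1≤i (<-trans i<t₂ t₂<n)) λ 2≡orbᵢ → <-irrefl (V.cyclic i t₂ (<-trans i<t₂ t₂<n) t₂<n (trans (sym 2≡orbᵢ) (sym orb-t₂))) i<t₂)
      , ≤∧≢⇒< orbᵢ≤orbⱼ λ orbᵢ≡orbⱼ → <-irrefl (V.cyclic i j (<-trans i<t₂ t₂<n) j<n orbᵢ≡orbⱼ) (<-trans i<t₂ t₂<j) )

    RunUpTo : ℕ → Set
    RunUpTo d = ∀ d′ → d′ ≤ d → orb (d′ + t₂) ≡ 2 + d′

    above-run : ∀ d → d + t₂ < n → RunUpTo d → ∀ t → 1 ≤ t → t < n → (∀ d′ → d′ ≤ d → t ≢ d′ + t₂) → 3 + d ≤ orb t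
    above-run d d+t₂<n run-so-far t 1≤t t<n outside = above-all (orb t) d (orb≥2 t 1≤t t<n) λ d′ d′≤d orbₜ≡2+d′ →
      outside d′ d′≤d (V.cyclic t (d′ + t₂) t<n (≤-<-trans (+-monoˡ-≤ t₂ d′≤d) d+t₂<n) (trans orbₜ≡2+d′ (sym (run-so-far d′ d′≤d))))

    module Next (d : ℕ) (bound : suc d + t₂ < n) (run-so-far : RunUpTo d) where
      x : ℕ
      x = orb (suc d + t₂)

      d+t₂<n : d + t₂ < n
      d+t₂<n = <-trans (n<1+n _) bound

      x≥3+d : 3 + d ≤ x
      x≥3+d = above-run d d+t₂<n run-so-far (suc d + t₂) (s≤s z≤n) bound λ d′ d′≤d e → <-irrefl (sym (+-cancelʳ-≡ t₂ _ _ e)) (s≤s d′≤d)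

      -- If 3 + d came later than x, the positions 1 < 2 + d < orb (e + t₂) < orb (1 + m′) would carry
      -- the values orb 1 > x > 3 + d > 2, in the pattern 4321.
      not-later : ∀ e → d < e → suc e + t₂ < n → orb (suc e + t₂) ≡ 3 + d → 3 + d < x → ⊥
      not-later e d<e bound′ orb≡3+d 3+d<x = V.avoids₄ 1 (2 + d) (orb (e + t₂)) (orb (suc m′)) ≤-refl (s≤s (s≤s z≤n))
        (above-run d d+t₂<n run-so-far (e + t₂) (≤-trans (s≤s z≤n) (m≤n+m t₂ e)) e+t₂<n λ d′ d′≤d eq → <-irrefl (sym (+-cancelʳ-≡ t₂ _ _ eq)) (≤-<-trans d′≤d d<e))
        (before-above-after (suc m′) (e + t₂) (s≤s z≤n) ≤-refl (+-monoˡ-< t₂ {0} (≤-<-trans z≤n d<e)) e+t₂<n)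
        (proj₂ (orb-within (suc m′)))
        (subst₄ Occ3421∪4321 refl (cong P (run-so-far d ≤-refl)) (sym orb≡3+d) (sym orb-t₂)
          (<-trans 3+d<x (before-above-after 1 (suc d + t₂) ≤-refl (s≤s (s≤s z≤n)) (s≤s (m≤n+m t₂ d)) bound) , 3+d<x , s≤s (s≤s (s≤s z≤n))))
        where
        e+t₂<n : e + t₂ < n
        e+t₂<n = <-trans (n<1+n _) bound′

      not-after-two : ∀ e → e + t₂ < n → orb (e + t₂) ≡ 3 + d → 3 + d < x → ⊥
      not-after-two e e+t₂<n orb≡3+d 3+d<x with ≤-<-connex e d
      ... | inj₁ e≤d = <-irrefl (suc-injective (suc-injective (trans (sym (run-so-far e e≤d)) orb≡3+d))) (s≤s e≤d)
      ... | inj₂ d<e with m≤n⇒m<n∨m≡n d<e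
      ...   | inj₂ refl = <-irrefl (sym orb≡3+d) 3+d<x
      not-after-two (suc e) e+t₂<n orb≡3+d 3+d<x | inj₂ _ | inj₁ 1+d<e = not-later e (≤-pred 1+d<e) e+t₂<n orb≡3+d 3+d<x

      nowhere : ∀ t → t < n → orb t ≡ 3 + d → 3 + d < x → ⊥
      nowhere zero _ () _
      nowhere (suc t) t<n orb≡3+d 3+d<x with split-at (suc t) t₂
      ... | inj₁ t<t₂ =
        <-asym 3+d<x (subst (x <_) orb≡3+d (before-above-after (suc t) (suc d + t₂) (s≤s z≤n) t<t₂ (s≤s (m≤n+m t₂ d)) bound))
      ... | inj₂ (e , 1+t≡e+t₂) = not-after-two e (subst (_< n) 1+t≡e+t₂ t<n) (trans (cong orb (sym 1+t≡e+t₂)) orb≡3+d) 3+d<x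

      next-in-run : x ≡ 3 + d
      next-in-run with m≤n⇒m<n∨m≡n x≥3+d
      ... | inj₂ 3+d≡x = sym 3+d≡x
      ... | inj₁ 3+d<x with covers (3 + d) (s≤s z≤n , ≤-trans (<⇒≤ 3+d<x) (proj₂ (orb-within (suc d + t₂))))
      ...   | t , t<n , orb≡3+d = ⊥-elim (nowhere t t<n orb≡3+d 3+d<x)

    run-after-two : ∀ d → d + t₂ < n → orb (d + t₂) ≡ 2 + d
    run-after-two = <-rec (λ d → d + t₂ < n → orb (d + t₂) ≡ 2 + d) step
      where
      step : ∀ d → (∀ {d′} → d′ < d → d′ + t₂ < n → orb (d′ + t₂) ≡ 2 + d′) → d + t₂ < n → orb (d + t₂) ≡ 2 + d
      step zero _ _ = orb-t₂
      step (suc d) earlier bound = Next.next-in-run d bound λ d′ d′≤d →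
        earlier (s≤s d′≤d) (≤-<-trans (+-monoˡ-≤ t₂ d′≤d) (<-trans (n<1+n _) bound))

    c : ℕ
    c = n ∸ (3 + m′)

    n≡3+c+m′ : n ≡ 3 + c + m′
    n≡3+c+m′ = trans (sym (m+[n∸m]≡n t₂<n)) (cong (3 +_) (+-comm m′ c))

    c+t₂<n : c + t₂ < n
    c+t₂<n = subst (c + t₂ <_) (sym n≡3+c+m′) (s≤s (≤-reflexive (trans (+-suc c (suc m′)) (cong suc (+-suc c m′)))))

    run-values : ∀ j → j < c → P (2 + j) ≡ 3 + j
    run-values j j<c = trans (cong P (sym (run-after-two j j+t₂<n))) (run-after-two (suc j) (≤-<-trans (+-monoˡ-≤ t₂ j<c) c+t₂<n))
      where
      j+t₂<n : j + t₂ < n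
      j+t₂<n = ≤-<-trans (+-monoˡ-≤ t₂ (<⇒≤ j<c)) c+t₂<n

    end-value : P (2 + c) ≡ 1
    end-value = begin
      P (2 + c)             ≡⟨ cong P (sym (run-after-two c c+t₂<n)) ⟩
      orb (suc (c + t₂))    ≡⟨ cong orb (trans (cong suc (trans (+-suc c (suc m′)) (cong suc (+-suc c m′)))) (sym n≡3+c+m′)) ⟩
      orb n                 ≡⟨ orbit-period 1≤n V.into V.injective V.cyclic ⟩
      1                     ∎
      where open ≡-Reasoning

    first-value : 3 + c ≤ P 1
    first-value = above-run c c+t₂<n (λ d′ d′≤c → run-after-two d′ (≤-<-trans (+-monoˡ-≤ t₂ d′≤c) c+t₂<n))
      1 ≤-refl (≤-trans (s≤s (s≤s z≤n)) t₂<n) λ d′ _ 1≡ → 2≰1 (subst (2 ≤_) (sym 1≡) (≤-trans (s≤s (s≤s z≤n)) (m≤n+m t₂ d′)))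

    lifted-values : ∀ r → r ≤ m′ → P (3 + c + r) ≡ 2 ⊎ 3 + c ≤ P (3 + c + r)
    lifted-values r r≤m′ = two-or-above c (P (3 + c + r)) (≤∧≢⇒< (proj₁ (V.into _ (s≤s z≤n) pos≤n)) not-end) not-run
      where
      pos≤n : 3 + c + r ≤ n
      pos≤n = subst (3 + c + r ≤_) (sym n≡3+c+m′) (+-monoʳ-≤ (3 + c) r≤m′)
      not-end : 1 ≢ P (3 + c + r)
      not-end 1≡ = <-irrefl (V.injective (2 + c) (3 + c + r) (s≤s z≤n) (≤-trans (n≤1+n _) (≤-trans (s≤s (s≤s (s≤s (m≤m+n c r)))) pos≤n))
                                          (s≤s z≤n) pos≤n (trans end-value 1≡)) (s≤s (s≤s (s≤s (m≤m+n c r))))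
      not-run : ∀ j → j < c → P (3 + c + r) ≢ 3 + j
      not-run j j<c e = <-irrefl (sym (V.injective (3 + c + r) (2 + j) (s≤s z≤n) pos≤n (s≤s z≤n)
                                   (≤-trans (s≤s (s≤s (≤-trans (<⇒≤ j<c) (m≤m+n c r)))) (≤-trans (n≤1+n _) pos≤n))
                                   (trans e (sym (run-values j j<c)))))
                                 (s≤s (s≤s (≤-trans j<c (≤-trans (m≤m+n c r) (n≤1+n _)))))

    decompose : Decomposition n P
    decompose = by-appendRun c m′ S n≡3+c+m′ (appendRun-pullback invariant-3421∪4321 invariant-213 proj₁ c m′ S avP′) P≗
      where
      S : ℕ → ℕ
      S = runDrop c ∘ P ∘ runPos c
      P≗′ : Agree (3 + c + m′) P (appendRun c S)
      P≗′ = appendRun-characterization c m′ P (inj₂ first-value) run-values end-value lifted-values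
      P≗ : Agree n P (appendRun c S)
      P≗ = subst (λ k → Agree k P (appendRun c S)) (sym n≡3+c+m′) P≗′
      avP′ : Avoider₁ (3 + c + m′) (appendRun c S)
      avP′ = CyclicAvoider-agree (s≤s z≤n) (subst (λ k → Avoider₁ k P) n≡3+c+m′ avP) P≗′

  decompose-at-two : P 1 ≡ 2 → Decomposition n P
  decompose-at-two P1≡2 = by-insertTwo m′ S n≡3+m′ (insertTwo-pullback invariant-3421∪4321 invariant-213 proj₁ m′ S avP′) P≗
    where
    m′ : ℕ
    m′ = n ∸ 3
    n≡3+m′ : n ≡ 3 + m′
    n≡3+m′ = sym (m+[n∸m]≡n 3≤n)
    S : ℕ → ℕ
    S = twoDrop ∘ P ∘ suc
    P≗ : Agree n P (insertTwo S)
    P≗ = insertTwo-characterization n P P1≡2 λ i 2≤i i≤n Pi≡2 →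
      <-irrefl (sym (V.injective i 1 (<⇒≤ 2≤i) i≤n ≤-refl 1≤n (trans Pi≡2 (sym P1≡2)))) 2≤i
    avP′ : Avoider₁ (3 + m′) (insertTwo S)
    avP′ = CyclicAvoider-agree (s≤s z≤n) (subst (λ k → Avoider₁ k P) n≡3+m′ avP) (subst (λ k → Agree k P (insertTwo S)) n≡3+m′ P≗)

  decomposition : Decomposition n P
  decomposition with P 1 ≟ 2
  ... | yes P1≡2 = decompose-at-two P1≡2
  ... | no P1≢2 with covers 2 (s≤s z≤n , ≤-trans (s≤s (s≤s z≤n)) 3≤n)
  ...   | zero , _ , ()
  ...   | suc zero , _ , P1≡2 = ⊥-elim (P1≢2 P1≡2)
  ...   | suc (suc m′) , t₂<n , orb-t₂ = AfterTwo.decompose m′ t₂<n orb-t₂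

-- Permutations as lists

table : ℕ → (ℕ → ℕ) → List ℕ
table n F = applyUpTo (F ∘ suc) n

length-table : ∀ n F → length (table n F) ≡ n
length-table n F = length-applyUpTo (F ∘ suc) n

apply-table : ∀ n F i → 1 ≤ i → i ≤ n → apply (table n F) i ≡ F i
apply-table (suc n) F (suc zero) _ _ = refl
apply-table (suc n) F (suc (suc i)) _ (s≤s i+1≤n) = apply-table n (F ∘ suc) (suc i) (s≤s z≤n) i+1≤n

table-apply : ∀ w → table (length w) (apply w) ≡ w
table-apply [] = refl
table-apply (x ∷ w) = cong (x ∷_) (table-apply w)

table-cong : ∀ n {F G} → Agree n F G → table n F ≡ table n G
table-cong zero _ = refl
table-cong (suc n) F≗G = cong₂ _∷_ (F≗G 1 ≤-refl (s≤s z≤n)) (table-cong n λ i 1≤i i≤n → F≗G (suc i) (s≤s z≤n) (s≤s i≤n))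

table-injective : ∀ n {F G} → table n F ≡ table n G → Agree n F G
table-injective n {F} {G} e i 1≤i i≤n = trans (sym (apply-table n F i 1≤i i≤n)) (trans (cong (λ w → apply w i) e) (apply-table n G i 1≤i i≤n))

apply-∈ : ∀ xs i → 1 ≤ i → i ≤ length xs → apply xs i ∈ xs
apply-∈ (x ∷ xs) (suc zero) _ _ = here refl
apply-∈ (x ∷ xs) (suc (suc i)) _ (s≤s i+1≤n) = there (apply-∈ xs (suc i) (s≤s z≤n) i+1≤n)

applyUpTo-unique⁺ : ∀ (f : ℕ → ℕ) n → (∀ i j → i < n → j < n → f i ≡ f j → i ≡ j) → Unique (applyUpTo f n)
applyUpTo-unique⁺ f n inj = Unique.applyUpTo⁺₁ f n λ {i} {j} i<j j<n e → <-irrefl (inj i j (<-trans i<j j<n) j<n e) i<j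

applyUpTo-unique⁻ : ∀ (f : ℕ → ℕ) n → Unique (applyUpTo f n) → ∀ i j → i < n → j < n → f i ≡ f j → i ≡ j
applyUpTo-unique⁻ f (suc n) (fresh ∷ rest) zero zero _ _ _ = refl
applyUpTo-unique⁻ f (suc n) (fresh ∷ rest) zero (suc j) _ (s≤s j<n) e = ⊥-elim (All.lookup fresh (∈-applyUpTo⁺ (f ∘ suc) j<n) e)
applyUpTo-unique⁻ f (suc n) (fresh ∷ rest) (suc i) zero (s≤s i<n) _ e = ⊥-elim (All.lookup fresh (∈-applyUpTo⁺ (f ∘ suc) i<n) (sym e))
applyUpTo-unique⁻ f (suc n) (_ ∷ rest) (suc i) (suc j) (s≤s i<n) (s≤s j<n) e = cong suc (applyUpTo-unique⁻ (f ∘ suc) n rest i j i<n j<n e)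

list-ext : ∀ {n σ τ} → length σ ≡ n → length τ ≡ n → Agree n (apply σ) (apply τ) → σ ≡ τ
list-ext {n} {σ} {τ} refl length-τ σ≗τ = begin
  σ                            ≡⟨ sym (table-apply σ) ⟩
  table n (apply σ)            ≡⟨ table-cong n σ≗τ ⟩
  table n (apply τ)            ≡⟨ subst (λ k → table k (apply τ) ≡ τ) length-τ (table-apply τ) ⟩
  τ                            ∎
  where open ≡-Reasoning

map-unique : ∀ {A B : Set} (f : A → B) {xs} → (∀ {x y} → x ∈ xs → y ∈ xs → f x ≡ f y → x ≡ y) → Unique xs → Unique (map f xs)
map-unique f {[]} _ [] = []
map-unique f {x ∷ xs} inj (x∉xs ∷ u) =
  Allₚ.map⁺ (All.tabulate λ y∈xs fx≡fy → All.lookup x∉xs y∈xs (inj (here refl) (there y∈xs) fx≡fy)) ∷ map-unique f (λ x∈ y∈ → inj (there x∈) (there y∈)) u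

same-members⇒same-length : ∀ {A : Set} {xs ys : List A} → Unique xs → Unique ys →
  (∀ {x} → x ∈ xs → x ∈ ys) → (∀ {x} → x ∈ ys → x ∈ xs) → length xs ≡ length ys
same-members⇒same-length u v to from = ↭-length (∼bag⇒↭ (unique∧set⇒bag u v (mk⇔ to from)))

length-concatMap : ∀ {A B : Set} (f : A → List B) xs → length (concatMap f xs) ≡ sum (map (length ∘ f) xs)
length-concatMap f [] = refl
length-concatMap f (x ∷ xs) = trans (length-++ (f x)) (cong (length (f x) +_) (length-concatMap f xs))

table-within⁻ : ∀ n F → All (Within n) (table n F) → MapsInto n F
table-within⁻ n F within (suc i) _ i<n = Allₚ.applyUpTo⁻ (F ∘ suc) n within i<n

table-within⁺ : ∀ n F → MapsInto n F → All (Within n) (table n F)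
table-within⁺ n F into = Allₚ.applyUpTo⁺₁ (F ∘ suc) n λ i<n → into _ (s≤s z≤n) i<n

table-unique⁻ : ∀ n F → Unique (table n F) → InjectiveOn n F
table-unique⁻ n F u (suc i) (suc j) _ i<n _ j<n e = cong suc (applyUpTo-unique⁻ (F ∘ suc) n u i j i<n j<n e)

table-unique⁺ : ∀ n F → InjectiveOn n F → Unique (table n F)
table-unique⁺ n F inj = applyUpTo-unique⁺ (F ∘ suc) n λ i j i<n j<n e → suc-injective (inj (suc i) (suc j) (s≤s z≤n) i<n (s≤s z≤n) j<n e)

∈-oneTo⁻ : ∀ {m x} → x ∈ oneTo m → Within m x
∈-oneTo⁻ x∈ with ∈-map⁻ suc x∈
... | i , i∈ , refl = s≤s z≤n , ∈-upTo⁻ i∈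

∈-oneTo⁺ : ∀ {m x} → Within m x → x ∈ oneTo m
∈-oneTo⁺ {x = suc x} (_ , x<m) = ∈-map⁺ suc (∈-upTo⁺ x<m)

∈-words⁻ : ∀ m k {w} → w ∈ words m k → length w ≡ k × All (Within m) w
∈-words⁻ m zero (here refl) = refl , []
∈-words⁻ m (suc k) w∈ with find (∈-concatMap⁻ (λ x → map (x ∷_) (words m k)) {xs = oneTo m} w∈)
... | x , x∈ , w∈x∷ with ∈-map⁻ (x ∷_) w∈x∷
...   | w′ , w′∈ , refl with ∈-words⁻ m k w′∈
...     | refl , within = refl , ∈-oneTo⁻ x∈ ∷ within

∈-words⁺ : ∀ m {w} → All (Within m) w → w ∈ words m (length w)
∈-words⁺ m [] = here refl
∈-words⁺ m {x ∷ w} (x-within ∷ within) = ∈-concatMap⁺ (λ y → map (y ∷_) (words m (length w))) (lose (∈-oneTo⁺ x-within) (∈-map⁺ (x ∷_) (∈-words⁺ m within)))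

words-unique : ∀ m k → Unique (words m k)
words-unique m zero = [] ∷ []
words-unique m (suc k) = Unique.concat⁺ (Allₚ.map⁺ (All.universal (λ _ → Unique.map⁺ ∷-injectiveʳ (words-unique m k)) (oneTo m)))
  (AllPairsₚ.map⁺ (AllPairs.map disjoint (Unique.map⁺ suc-injective (Unique.upTo⁺ m))))
  where
  disjoint : ∀ {x y} → x ≢ y → Disjoint (map (x ∷_) (words m k)) (map (y ∷_) (words m k))
  disjoint x≢y (v∈x , v∈y) with ∈-map⁻ _ v∈x | ∈-map⁻ _ v∈y
  ... | _ , _ , refl | _ , _ , e = x≢y (∷-injectiveˡ e)

T-not⁻ : ∀ {b} → T (not b) → ¬ T b
T-not⁻ {false} _ ()

T-not⁺ : ∀ {b} → ¬ T b → T (not b)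
T-not⁺ {false} _ = _
T-not⁺ {true} ¬t = ¬t _

allDistinct⇒Unique : ∀ xs → T (allDistinct xs) → Unique xs
allDistinct⇒Unique [] _ = []
allDistinct⇒Unique (x ∷ xs) t with Equivalence.to T-∧ t
... | fresh , rest = Allₚ.¬Any⇒All¬ xs (T-not⁻ fresh ∘ any⁺ _ ∘ AnyM.map (≡⇒≡ᵇ x _)) ∷ allDistinct⇒Unique xs rest

Unique⇒allDistinct : ∀ xs → Unique xs → T (allDistinct xs)
Unique⇒allDistinct [] _ = _
Unique⇒allDistinct (x ∷ xs) (fresh ∷ rest) =
  Equivalence.from T-∧ (T-not⁺ (Allₚ.All¬⇒¬Any fresh ∘ AnyM.map (≡ᵇ⇒≡ x _) ∘ any⁻ _ xs) , Unique⇒allDistinct xs rest)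

iterate-applyUpTo : ∀ (f g : ℕ → ℕ) → (∀ s → g (suc s) ≡ f (g s)) → ∀ k → iterate f (g 0) k ≡ applyUpTo g k
iterate-applyUpTo f g step zero = refl
iterate-applyUpTo f g step (suc k) = cong (g 0 ∷_) (trans (cong (λ x → iterate f x k) (sym (step 0))) (iterate-applyUpTo f (g ∘ suc) (step ∘ suc) k))

iterate-unique : ∀ (f : ℕ → ℕ) (G : ℕ → ℕ → List ℕ) → (∀ x → G 0 x ≡ []) → (∀ k x → G (suc k) x ≡ x ∷ G k (f x)) → ∀ k x → G k x ≡ iterate f x k
iterate-unique f G G-zero G-suc zero x = G-zero x
iterate-unique f G G-zero G-suc (suc k) x = trans (G-suc k x) (cong (x ∷_) (iterate-unique f G G-zero G-suc k (f x)))

-- cycleForm is defined through a local helper; abstracting its arguments lets Agda solve G with that helper.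
cycleForm-iterate : ∀ w → cycleForm w ≡ iterate (apply w) 1 (length w)
cycleForm-iterate w with length w | 1 | iterate-unique (apply w) _ (λ _ → refl) (λ _ _ → refl)
... | k | x | go≡iterate = go≡iterate k x

cycleForm-orbit : ∀ w → cycleForm w ≡ applyUpTo (orbit (apply w)) (length w)
cycleForm-orbit w = trans (cycleForm-iterate w) (iterate-applyUpTo (apply w) (orbit (apply w)) (λ _ → refl) (length w))

Increasing : ℕ → ℕ → List ℕ → Set
Increasing b e [] = ⊤
Increasing b e (i ∷ I) = b ≤ i × i < e × Increasing (suc i) e I

increasing-weaken : ∀ {b b′ e} I → b ≤ b′ → Increasing b′ e I → Increasing b e I
increasing-weaken [] _ _ = _
increasing-weaken (i ∷ I) b≤b′ (b′≤i , i<e , rest) = ≤-trans b≤b′ b′≤i , i<e , rest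

increasing-shift : ∀ {b e} I → Increasing b e I → Increasing (suc b) (suc e) (map suc I)
increasing-shift [] _ = _
increasing-shift (i ∷ I) (b≤i , i<e , rest) = s≤s b≤i , s≤s i<e , increasing-shift I rest

increasing-unshift : ∀ {b e} I → Increasing (suc b) (suc e) I → ∃[ I′ ] I ≡ map suc I′ × Increasing b e I′
increasing-unshift [] _ = [] , refl , _
increasing-unshift (suc i ∷ I) (s≤s b≤i , s≤s i<e , rest) with increasing-unshift I rest
... | I′ , refl , rest′ = i ∷ I′ , refl , b≤i , i<e , rest′

length≡4 : ∀ (I : List ℕ) → length I ≡ 4 → ∃[ i ] ∃[ j ] ∃[ k ] ∃[ l ] I ≡ i ∷ j ∷ k ∷ l ∷ []
length≡4 (i ∷ j ∷ k ∷ l ∷ []) refl = i , j , k , l , refl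

length≡3 : ∀ (I : List ℕ) → length I ≡ 3 → ∃[ i ] ∃[ j ] ∃[ k ] I ≡ i ∷ j ∷ k ∷ []
length≡3 (i ∷ j ∷ k ∷ []) refl = i , j , k , refl

increasing₃ : ∀ {b i j k n} → b ≤ i → i < j → j < k → k < n → Increasing b n (i ∷ j ∷ k ∷ [])
increasing₃ b≤i i<j j<k k<n = b≤i , <-trans i<j (<-trans j<k k<n) , i<j , <-trans j<k k<n , j<k , k<n , _

increasing₄ : ∀ {b i j k l n} → b ≤ i → i < j → j < k → k < l → l < n → Increasing b n (i ∷ j ∷ k ∷ l ∷ [])
increasing₄ b≤i i<j j<k k<l l<n = b≤i , <-trans i<j (<-trans j<k (<-trans k<l l<n)) , increasing₃ i<j j<k k<l l<n

[]∈subseqs : ∀ (xs : List ℕ) → [] ∈ subseqs xs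
[]∈subseqs [] = here refl
[]∈subseqs (x ∷ xs) = ∈-++⁺ʳ (map (x ∷_) (subseqs xs)) ([]∈subseqs xs)

∈-subseqs⁻ : ∀ (g : ℕ → ℕ) n {u} → u ∈ subseqs (applyUpTo g n) → ∃[ I ] Increasing 0 n I × u ≡ map g I
∈-subseqs⁻ g zero (here refl) = [] , _ , refl
∈-subseqs⁻ g (suc n) u∈ with ∈-++⁻ (map (g 0 ∷_) (subseqs (applyUpTo (g ∘ suc) n))) u∈
... | inj₁ u∈₁ with ∈-map⁻ (g 0 ∷_) u∈₁
...   | u′ , u′∈ , refl with ∈-subseqs⁻ (g ∘ suc) n u′∈
...     | I , inc , refl = 0 ∷ map suc I , (z≤n , s≤s z≤n , increasing-shift I inc) , cong (g 0 ∷_) (map-∘ I)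
∈-subseqs⁻ g (suc n) u∈ | inj₂ u∈₂ with ∈-subseqs⁻ (g ∘ suc) n u∈₂
... | I , inc , refl = map suc I , increasing-weaken (map suc I) z≤n (increasing-shift I inc) , map-∘ I

∈-subseqs⁺ : ∀ (g : ℕ → ℕ) n I → Increasing 0 n I → map g I ∈ subseqs (applyUpTo g n)
∈-subseqs⁺ g n [] _ = []∈subseqs (applyUpTo g n)
∈-subseqs⁺ g (suc n) (zero ∷ I) (_ , _ , rest) with increasing-unshift I rest
... | I′ , refl , rest′ = ∈-++⁺ˡ (∈-map⁺ (g 0 ∷_) (subst (_∈ subseqs (applyUpTo (g ∘ suc) n)) (map-∘ I′) (∈-subseqs⁺ (g ∘ suc) n I′ rest′)))
∈-subseqs⁺ g (suc n) (suc i ∷ I) (_ , i<n , rest) with increasing-unshift (suc i ∷ I) (s≤s z≤n , i<n , rest)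
... | I′ , eq , rest′ = ∈-++⁺ʳ (map (g 0 ∷_) (subseqs (applyUpTo (g ∘ suc) n)))
        (subst (_∈ subseqs (applyUpTo (g ∘ suc) n)) (trans (map-∘ I′) (cong (map g) (sym eq))) (∈-subseqs⁺ (g ∘ suc) n I′ rest′))

contains-applyUpTo⁻ : ∀ (g : ℕ → ℕ) n σ → T (contains (applyUpTo g n) σ) → ∃[ I ] Increasing 0 n I × T (orderIso (map g I) σ)
contains-applyUpTo⁻ g n σ t with find (any⁻ (λ u → orderIso u σ) (subseqs (applyUpTo g n)) t)
... | u , u∈ , iso with ∈-subseqs⁻ g n u∈
...   | I , inc , refl = I , inc , iso

contains-applyUpTo⁺ : ∀ (g : ℕ → ℕ) n σ I → Increasing 0 n I → T (orderIso (map g I) σ) → T (contains (applyUpTo g n) σ)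
contains-applyUpTo⁺ g n σ I inc iso = any⁺ (λ u → orderIso u σ) (lose (∈-subseqs⁺ g n I inc) iso)

orderIso-length : ∀ u σ → T (orderIso u σ) → length u ≡ length σ
orderIso-length [] [] _ = refl
orderIso-length (a ∷ u) (b ∷ σ) t = cong suc (orderIso-length u σ (proj₂ (Equivalence.to T-∧ t)))

<ᵇ-true : ∀ {x y} → x < y → (x <ᵇ y) ≡ true
<ᵇ-true x<y = Equivalence.to T-≡ (<⇒<ᵇ x<y)

<ᵇ-false : ∀ {x y} → y ≤ x → (x <ᵇ y) ≡ false
<ᵇ-false {x} {y} y≤x = Equivalence.to T-not-≡ (T-not⁺ λ t → <⇒≱ (<ᵇ⇒< x y t) y≤x)

true⇒< : ∀ {x y} → (x <ᵇ y) ≡ true → x < y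
true⇒< {x} {y} e = <ᵇ⇒< x y (Equivalence.from T-≡ e)

false⇒≥ : ∀ {x y} → (x <ᵇ y) ≡ false → y ≤ x
false⇒≥ {x} {y} e = ≮⇒≥ λ x<y → subst T e (<⇒<ᵇ x<y)

p3421 p4321 p4312 p213 p312 : List ℕ
p3421 = 3 ∷ 4 ∷ 2 ∷ 1 ∷ []
p4321 = 4 ∷ 3 ∷ 2 ∷ 1 ∷ []
p4312 = 4 ∷ 3 ∷ 1 ∷ 2 ∷ []
p213 = 2 ∷ 1 ∷ 3 ∷ []
p312 = 3 ∷ 1 ∷ 2 ∷ []

-- Each chain follows the evaluation order of orderIso, so that a wrong answer reduces the hypothesis to T false.
iso3421⇒ : ∀ a b c d → T (orderIso (a ∷ b ∷ c ∷ d ∷ []) p3421) → Occ3421∪4321 a b c d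
iso3421⇒ a b c d t with b <ᵇ a
... | true = ⊥-elim t
... | false with c <ᵇ a in c<a
...   | false = ⊥-elim t
...   | true with d <ᵇ a
...     | false = ⊥-elim t
...     | true with c <ᵇ b in c<b
...       | false = ⊥-elim t
...       | true with d <ᵇ b
...         | false = ⊥-elim t
...         | true with d <ᵇ c in d<c
...           | false = ⊥-elim t
...           | true = true⇒< c<a , true⇒< c<b , true⇒< d<c

iso4321⇒₁ : ∀ a b c d → T (orderIso (a ∷ b ∷ c ∷ d ∷ []) p4321) → Occ3421∪4321 a b c d
iso4321⇒₁ a b c d t with b <ᵇ a
... | false = ⊥-elim t
... | true with c <ᵇ a in c<a
...   | false = ⊥-elim t
...   | true with d <ᵇ a
...     | false = ⊥-elim t
...     | true with c <ᵇ b in c<b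
...       | false = ⊥-elim t
...       | true with d <ᵇ b
...         | false = ⊥-elim t
...         | true with d <ᵇ c in d<c
...           | false = ⊥-elim t
...           | true = true⇒< c<a , true⇒< c<b , true⇒< d<c

iso4321⇒₂ : ∀ a b c d → T (orderIso (a ∷ b ∷ c ∷ d ∷ []) p4321) → Occ4312∪4321 a b c d
iso4321⇒₂ a b c d t with b <ᵇ a in b<a
... | false = ⊥-elim t
... | true with c <ᵇ a
...   | false = ⊥-elim t
...   | true with d <ᵇ a
...     | false = ⊥-elim t
...     | true with c <ᵇ b in c<b
...       | false = ⊥-elim t
...       | true with d <ᵇ b in d<b
...         | false = ⊥-elim t
...         | true = true⇒< b<a , true⇒< c<b , true⇒< d<b

iso4312⇒ : ∀ a b c d → T (orderIso (a ∷ b ∷ c ∷ d ∷ []) p4312) → Occ4312∪4321 a b c d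
iso4312⇒ a b c d t with b <ᵇ a in b<a
... | false = ⊥-elim t
... | true with c <ᵇ a
...   | false = ⊥-elim t
...   | true with d <ᵇ a
...     | false = ⊥-elim t
...     | true with c <ᵇ b in c<b
...       | false = ⊥-elim t
...       | true with d <ᵇ b in d<b
...         | false = ⊥-elim t
...         | true = true⇒< b<a , true⇒< c<b , true⇒< d<b

iso213⇒ : ∀ a b c → T (orderIso (a ∷ b ∷ c ∷ []) p213) → a ≢ c → Occ213 a b c
iso213⇒ a b c t a≢c with b <ᵇ a in b<a
... | false = ⊥-elim t
... | true with c <ᵇ a in c≮a
...   | true = ⊥-elim t
...   | false with c <ᵇ b
...     | true = ⊥-elim t
...     | false = true⇒< b<a , ≤∧≢⇒< (false⇒≥ c≮a) a≢c

iso312⇒ : ∀ a b c → T (orderIso (a ∷ b ∷ c ∷ []) p312) → b ≢ c → Occ312 a b c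
iso312⇒ a b c t b≢c with b <ᵇ a
... | false = ⊥-elim t
... | true with c <ᵇ a in c<a
...   | false = ⊥-elim t
...   | true with c <ᵇ b in c≮b
...     | true = ⊥-elim t
...     | false = ≤∧≢⇒< (false⇒≥ c≮b) b≢c , true⇒< c<a

⇒iso3421∪4321 : ∀ a b c d → Occ3421∪4321 a b c d → T (orderIso (a ∷ b ∷ c ∷ d ∷ []) p3421) ⊎ T (orderIso (a ∷ b ∷ c ∷ d ∷ []) p4321)
⇒iso3421∪4321 a b c d (c<a , c<b , d<c)
  rewrite <ᵇ-true c<a | <ᵇ-true c<b | <ᵇ-true d<c | <ᵇ-true (<-trans d<c c<a) | <ᵇ-true (<-trans d<c c<b) with b <ᵇ a
... | true = inj₂ _
... | false = inj₁ _

⇒iso4312∪4321 : ∀ a b c d → Occ4312∪4321 a b c d → T (orderIso (a ∷ b ∷ c ∷ d ∷ []) p4312) ⊎ T (orderIso (a ∷ b ∷ c ∷ d ∷ []) p4321)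
⇒iso4312∪4321 a b c d (b<a , c<b , d<b)
  rewrite <ᵇ-true b<a | <ᵇ-true c<b | <ᵇ-true d<b | <ᵇ-true (<-trans c<b b<a) | <ᵇ-true (<-trans d<b b<a) with d <ᵇ c
... | true = inj₂ _
... | false = inj₁ _

⇒iso213 : ∀ a b c → Occ213 a b c → T (orderIso (a ∷ b ∷ c ∷ []) p213)
⇒iso213 a b c (b<a , a<c) rewrite <ᵇ-true b<a | <ᵇ-false (<⇒≤ a<c) | <ᵇ-false (<⇒≤ (<-trans b<a a<c)) = _

⇒iso312 : ∀ a b c → Occ312 a b c → T (orderIso (a ∷ b ∷ c ∷ []) p312)
⇒iso312 a b c (b<c , c<a) rewrite <ᵇ-true (<-trans b<c c<a) | <ᵇ-true c<a | <ᵇ-false (<⇒≤ b<c) = _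

module Bridge (pa pb ρ : List ℕ) (R₄ : Rel₄) (R₃ : Rel₃)
  (length-pa : length pa ≡ 4) (length-pb : length pb ≡ 4) (length-ρ : length ρ ≡ 3)
  (iso⇒₄ᵃ : ∀ a b c d → T (orderIso (a ∷ b ∷ c ∷ d ∷ []) pa) → R₄ a b c d)
  (iso⇒₄ᵇ : ∀ a b c d → T (orderIso (a ∷ b ∷ c ∷ d ∷ []) pb) → R₄ a b c d)
  (⇒iso₄ : ∀ a b c d → R₄ a b c d → T (orderIso (a ∷ b ∷ c ∷ d ∷ []) pa) ⊎ T (orderIso (a ∷ b ∷ c ∷ d ∷ []) pb))
  (iso⇒₃ : ∀ a b c → T (orderIso (a ∷ b ∷ c ∷ []) ρ) → a ≢ b → b ≢ c → a ≢ c → R₃ a b c)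
  (⇒iso₃ : ∀ a b c → R₃ a b c → T (orderIso (a ∷ b ∷ c ∷ []) ρ)) where

  module _ (w : List ℕ) where
    private
      n = length w
      g = apply w ∘ suc

      contains⁻ : ∀ p → T (contains w p) → ∃[ I ] Increasing 0 n I × T (orderIso (map g I) p)
      contains⁻ p = contains-applyUpTo⁻ g n p ∘ subst (λ u → T (contains u p)) (sym (table-apply w))

      contains⁺ : ∀ p I → Increasing 0 n I → T (orderIso (map g I) p) → T (contains w p)
      contains⁺ p I inc = subst (λ u → T (contains u p)) (table-apply w) ∘ contains-applyUpTo⁺ g n p I inc

    avoids₄⁺ : ∀ p → length p ≡ 4 → (∀ a b c d → T (orderIso (a ∷ b ∷ c ∷ d ∷ []) p) → R₄ a b c d) →
      Avoids₄ R₄ n (apply w) → T (avoids w p)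
    avoids₄⁺ p length-p iso⇒ avoid = T-not⁺ λ t → found (contains⁻ p t)
      where
      found : ∃[ I ] Increasing 0 n I × T (orderIso (map g I) p) → ⊥
      found (I , inc , iso) with length≡4 I (trans (sym (length-map g I)) (trans (orderIso-length (map g I) p iso) length-p))
      ... | i , j , k , l , refl with inc
      ...   | _ , _ , i<j , _ , j<k , _ , k<l , l<n , _ =
        avoid (suc i) (suc j) (suc k) (suc l) (s≤s z≤n) (s≤s i<j) (s≤s j<k) (s≤s k<l) l<n (iso⇒ _ _ _ _ iso)

    avoids₄⁻ : T (avoids w pa) → T (avoids w pb) → Avoids₄ R₄ n (apply w)
    avoids₄⁻ avoid-a avoid-b (suc i) (suc j) (suc k) (suc l) _ (s≤s i<j) (s≤s j<k) (s≤s k<l) l<n occ with ⇒iso₄ _ _ _ _ occ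
    ... | inj₁ iso = T-not⁻ avoid-a (contains⁺ pa _ (increasing₄ z≤n i<j j<k k<l l<n) iso)
    ... | inj₂ iso = T-not⁻ avoid-b (contains⁺ pb _ (increasing₄ z≤n i<j j<k k<l l<n) iso)

    avoids₃⁺ : Cyclic n (apply w) → Avoids₃ R₃ n (orbit (apply w)) → T (avoids (cycleForm w) ρ)
    avoids₃⁺ cyc avoid = T-not⁺ λ t → found (contains-applyUpTo⁻ (orbit (apply w)) n ρ (subst (λ u → T (contains u ρ)) (cycleForm-orbit w) t))
      where
      distinct : ∀ {i j} → i < j → j < n → orbit (apply w) i ≢ orbit (apply w) j
      distinct i<j j<n e = <-irrefl (cyc _ _ (<-trans i<j j<n) j<n e) i<j
      found : ∃[ I ] Increasing 0 n I × T (orderIso (map (orbit (apply w)) I) ρ) → ⊥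
      found (I , inc , iso) with length≡3 I (trans (sym (length-map (orbit (apply w)) I)) (trans (orderIso-length (map (orbit (apply w)) I) ρ iso) length-ρ))
      ... | i , j , k , refl with inc
      ...   | _ , _ , i<j , _ , j<k , k<n , _ = avoid i j k i<j j<k k<n
        (iso⇒₃ _ _ _ iso (distinct i<j (<-trans j<k k<n)) (distinct j<k k<n) (distinct (<-trans i<j j<k) k<n))

    avoids₃⁻ : T (avoids (cycleForm w) ρ) → Avoids₃ R₃ n (orbit (apply w))
    avoids₃⁻ avoid i j k i<j j<k k<n occ = T-not⁻ avoid (subst (λ u → T (contains u ρ)) (sym (cycleForm-orbit w))
      (contains-applyUpTo⁺ (orbit (apply w)) n ρ _ (increasing₃ z≤n i<j j<k k<n) (⇒iso₃ _ _ _ occ)))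

  𝒜-unique : ∀ n → Unique (𝒜 n (pa ∷ pb ∷ []) ρ)
  𝒜-unique n = Unique.filter⁺ _ (Unique.filter⁺ _ (words-unique n n))

  ∈𝒜⁻ : ∀ {n w} → w ∈ 𝒜 n (pa ∷ pb ∷ []) ρ → length w ≡ n × CyclicAvoider R₄ R₃ n (apply w)
  ∈𝒜⁻ {n} {w} w∈ with ∈-filter⁻ (λ w → T? (isCyclic w ∧ all (avoids w) (pa ∷ pb ∷ []) ∧ avoids (cycleForm w) ρ)) {xs = perms n} w∈
  ... | w∈perms , conditions with ∈-filter⁻ (λ w → T? (allDistinct w)) {xs = words n n} w∈perms
  ...   | w∈words , distinct with ∈-words⁻ n n w∈words
  ...     | refl , within with Equivalence.to T-∧ conditions
  ...       | cyclic , avoiding with Equivalence.to T-∧ avoiding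
  ...         | avoiding₄ , avoiding₃ with Equivalence.to T-∧ avoiding₄
  ...           | avoiding-a , avoiding-b = refl , record
    { into = table-within⁻ n (apply w) (subst (All (Within n)) (sym (table-apply w)) within)
    ; injective = table-unique⁻ n (apply w) (subst Unique (sym (table-apply w)) (allDistinct⇒Unique w distinct))
    ; cyclic = applyUpTo-unique⁻ (orbit (apply w)) n (subst Unique (cycleForm-orbit w) (allDistinct⇒Unique (cycleForm w) cyclic))
    ; avoids₄ = avoids₄⁻ w avoiding-a (proj₁ (Equivalence.to T-∧ avoiding-b))
    ; avoids₃ = avoids₃⁻ w avoiding₃
    }

  ∈𝒜⁺ : ∀ {n w} → length w ≡ n → CyclicAvoider R₄ R₃ n (apply w) → w ∈ 𝒜 n (pa ∷ pb ∷ []) ρ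
  ∈𝒜⁺ {w = w} refl v = ∈-filter⁺ (λ w → T? (isCyclic w ∧ all (avoids w) (pa ∷ pb ∷ []) ∧ avoids (cycleForm w) ρ))
    (∈-filter⁺ (λ w → T? (allDistinct w)) (∈-words⁺ n within) distinct)
    (Equivalence.from T-∧ (cyclic , Equivalence.from T-∧ (Equivalence.from T-∧ (avoiding-a , Equivalence.from T-∧ (avoiding-b , _)) , avoiding₃)))
    where
    open CyclicAvoider v renaming (cyclic to cyc)
    n = length w
    within : All (Within n) w
    within = subst (All (Within n)) (table-apply w) (table-within⁺ n (apply w) into)
    distinct : T (allDistinct w)
    distinct = Unique⇒allDistinct w (subst Unique (table-apply w) (table-unique⁺ n (apply w) injective))
    cyclic : T (isCyclic w)
    cyclic = Unique⇒allDistinct (cycleForm w) (subst Unique (sym (cycleForm-orbit w)) (applyUpTo-unique⁺ (orbit (apply w)) n cyc))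
    avoiding-a : T (avoids w pa)
    avoiding-a = avoids₄⁺ w pa length-pa iso⇒₄ᵃ avoids₄
    avoiding-b : T (avoids w pb)
    avoiding-b = avoids₄⁺ w pb length-pb iso⇒₄ᵇ avoids₄
    avoiding₃ : T (avoids (cycleForm w) ρ)
    avoiding₃ = avoids₃⁺ w cyc avoids₃

-- Counting the first family

module Bridge₁ = Bridge p3421 p4321 p213 Occ3421∪4321 Occ213 refl refl refl iso3421⇒ iso4321⇒₁ ⇒iso3421∪4321
  (λ a b c iso _ _ a≢c → iso213⇒ a b c iso a≢c) ⇒iso213

𝒜₁ : ℕ → List (List ℕ)
𝒜₁ n = 𝒜 n (p3421 ∷ p4321 ∷ []) p213

table-avoider : ∀ {R₄ R₃ n F} → 1 ≤ n → CyclicAvoider R₄ R₃ n F → CyclicAvoider R₄ R₃ n (apply (table n F))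
table-avoider {n = n} {F} 1≤n v = CyclicAvoider-agree 1≤n v λ i 1≤i i≤n → sym (apply-table n F i 1≤i i≤n)

∈𝒜₁-table : ∀ {n F} → 1 ≤ n → Avoider₁ n F → table n F ∈ 𝒜₁ n
∈𝒜₁-table {n} {F} 1≤n v = Bridge₁.∈𝒜⁺ (length-table n F) (table-avoider 1≤n v)

insertTwo-cong : ∀ m {S S′} → Agree m S S′ → Agree (suc m) (insertTwo S) (insertTwo S′)
insertTwo-cong m S≗S′ (suc zero) _ _ = refl
insertTwo-cong m S≗S′ (suc (suc i)) _ (s≤s i+1≤m) = cong twoLift (S≗S′ (suc i) (s≤s z≤n) i+1≤m)

appendRun-cong : ∀ c m′ {S S′} → Agree (2 + m′) S S′ → Agree (3 + c + m′) (appendRun c S) (appendRun c S′)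
appendRun-cong c m′ {S} {S′} S≗S′ i 1≤i i≤n with runPosition c m′ i 1≤i i≤n
... | first = cong (runLift c) (S≗S′ 1 ≤-refl (s≤s z≤n))
... | run j j<c = trans (appendRun-run c S j j<c) (sym (appendRun-run c S′ j j<c))
... | end = trans (appendRun-end c S) (sym (appendRun-end c S′))
... | lifted r r≤m′ = trans (appendRun-lifted c S r) (trans (cong (runLift c) (S≗S′ (2 + r) (s≤s z≤n) (s≤s (s≤s r≤m′)))) (sym (appendRun-lifted c S′ r)))

insertTwoList : ℕ → List ℕ → List ℕ
insertTwoList m′ σ = table (3 + m′) (insertTwo (apply σ))

appendRunList : ℕ → ℕ → List ℕ → List ℕ
appendRunList c m′ σ = table (3 + c + m′) (appendRun c (apply σ))

appendRunLists : ℕ → ℕ → List (List ℕ)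
appendRunLists n′ m′ = map (appendRunList (n′ ∸ m′) m′) (𝒜₁ (2 + m′))

decomposed : ℕ → List (List ℕ)
decomposed n′ = map (insertTwoList n′) (𝒜₁ (2 + n′)) ++ concatMap (appendRunLists n′) (upTo (suc n′))

decomposed⊆𝒜₁ : ∀ n′ {w} → w ∈ decomposed n′ → w ∈ 𝒜₁ (3 + n′)
decomposed⊆𝒜₁ n′ w∈ with ∈-++⁻ (map (insertTwoList n′) (𝒜₁ (2 + n′))) w∈
... | inj₁ w∈₁ with ∈-map⁻ (insertTwoList n′) w∈₁
...   | σ , σ∈ , refl = ∈𝒜₁-table (s≤s z≤n) (insertTwo-avoider n′ (apply σ) (proj₂ (Bridge₁.∈𝒜⁻ σ∈)))
decomposed⊆𝒜₁ n′ w∈ | inj₂ w∈₂ with find (∈-concatMap⁻ (appendRunLists n′) {xs = upTo (suc n′)} w∈₂)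
... | m′ , m′∈ , w∈appendRunLists with ∈-map⁻ (appendRunList (n′ ∸ m′) m′) w∈appendRunLists
...   | σ , σ∈ , refl = subst (λ k → appendRunList (n′ ∸ m′) m′ σ ∈ 𝒜₁ k) (cong (3 +_) (m∸n+n≡m (≤-pred (∈-upTo⁻ m′∈))))
          (∈𝒜₁-table (s≤s z≤n) (appendRun-avoider (n′ ∸ m′) m′ (apply σ) (proj₂ (Bridge₁.∈𝒜⁻ σ∈))))

𝒜₁⊆decomposed : ∀ n′ {w} → w ∈ 𝒜₁ (3 + n′) → w ∈ decomposed n′
𝒜₁⊆decomposed n′ {w} w∈ with Bridge₁.∈𝒜⁻ w∈
... | length-w , avw with Decompose.decomposition avw (s≤s (s≤s (s≤s z≤n)))
...   | by-insertTwo .n′ S refl avS P≗ = ∈-++⁺ˡ (subst (_∈ map (insertTwoList n′) (𝒜₁ (2 + n′))) (sym w≡) (∈-map⁺ (insertTwoList n′) σ∈))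
  where
  σ : List ℕ
  σ = table (2 + n′) S
  σ∈ : σ ∈ 𝒜₁ (2 + n′)
  σ∈ = ∈𝒜₁-table (s≤s z≤n) avS
  w≡ : w ≡ insertTwoList n′ σ
  w≡ = begin
    w                                      ≡⟨ subst (λ k → w ≡ table k (apply w)) length-w (sym (table-apply w)) ⟩
    table (3 + n′) (apply w)               ≡⟨ table-cong (3 + n′) P≗ ⟩
    table (3 + n′) (insertTwo S)           ≡⟨ table-cong (3 + n′) (insertTwo-cong (2 + n′) λ i 1≤i i≤m → sym (apply-table (2 + n′) S i 1≤i i≤m)) ⟩
    insertTwoList n′ σ                     ∎
    where open ≡-Reasoning
...   | by-appendRun c m′ S refl avS P≗ = ∈-++⁺ʳ (map (insertTwoList n′) (𝒜₁ (2 + n′)))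
          (∈-concatMap⁺ (appendRunLists n′) (lose (∈-upTo⁺ (s≤s (m≤n+m m′ c))) (subst (_∈ appendRunLists n′ m′) (sym w≡) (∈-map⁺ (appendRunList (n′ ∸ m′) m′) σ∈))))
  where
  σ : List ℕ
  σ = table (2 + m′) S
  σ∈ : σ ∈ 𝒜₁ (2 + m′)
  σ∈ = ∈𝒜₁-table (s≤s z≤n) avS
  w≡ : w ≡ appendRunList (n′ ∸ m′) m′ σ
  w≡ = begin
    w                                      ≡⟨ subst (λ k → w ≡ table k (apply w)) length-w (sym (table-apply w)) ⟩
    table (3 + c + m′) (apply w)           ≡⟨ table-cong (3 + c + m′) P≗ ⟩
    table (3 + c + m′) (appendRun c S)     ≡⟨ table-cong (3 + c + m′) (appendRun-cong c m′ λ i 1≤i i≤m → sym (apply-table (2 + m′) S i 1≤i i≤m)) ⟩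
    appendRunList c m′ σ                   ≡⟨ cong (λ c′ → appendRunList c′ m′ σ) (sym (m+n∸n≡m c m′)) ⟩
    appendRunList (n′ ∸ m′) m′ σ           ∎
    where open ≡-Reasoning

insertTwoList-injective : ∀ m′ {σ τ} → length σ ≡ 2 + m′ → length τ ≡ 2 + m′ → insertTwoList m′ σ ≡ insertTwoList m′ τ → σ ≡ τ
insertTwoList-injective m′ {σ} {τ} length-σ length-τ e = list-ext length-σ length-τ λ { (suc i) _ i+1≤m →
  monotone-injective twoLift-mono (table-injective (3 + m′) {insertTwo (apply σ)} {insertTwo (apply τ)} e (2 + i) (s≤s z≤n) (s≤s i+1≤m)) }

appendRunList-injective : ∀ c m′ {σ τ} → length σ ≡ 2 + m′ → length τ ≡ 2 + m′ → appendRunList c m′ σ ≡ appendRunList c m′ τ → σ ≡ τ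
appendRunList-injective c m′ {σ} {τ} length-σ length-τ e = list-ext length-σ length-τ λ i 1≤i i≤m →
  monotone-injective (runLift-mono c) (begin
    runLift c (apply σ i)                 ≡⟨ appendRun-runPos c (apply σ) i 1≤i ⟨
    appendRun c (apply σ) (runPos c i)    ≡⟨ table-injective (3 + c + m′) {appendRun c (apply σ)} {appendRun c (apply τ)} e (runPos c i) (proj₁ (pos-within i 1≤i i≤m)) (proj₂ (pos-within i 1≤i i≤m)) ⟩
    appendRun c (apply τ) (runPos c i)    ≡⟨ appendRun-runPos c (apply τ) i 1≤i ⟩
    runLift c (apply τ i)                 ∎)
  where
  open ≡-Reasoning
  pos-within : ∀ i → 1 ≤ i → i ≤ 2 + m′ → Within (3 + c + m′) (runPos c i)
  pos-within i 1≤i i≤m = AppendRun.runPos-within c m′ (apply σ) i (1≤i , i≤m)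

appendRunList-run≢end : ∀ {c₁ c₂ m₁ m₂} σ τ → c₁ < c₂ → appendRunList c₁ m₁ σ ≢ appendRunList c₂ m₂ τ
appendRunList-run≢end {c₁} {c₂} {m₁} {m₂} σ τ c₁<c₂ e with
  trans (sym (apply-table (3 + c₁ + m₁) (appendRun c₁ (apply σ)) (2 + c₁) (s≤s z≤n) (s≤s (s≤s (m≤n⇒m≤1+n (m≤m+n c₁ m₁))))))
  (trans (cong (λ w → apply w (2 + c₁)) e) (apply-table (3 + c₂ + m₂) (appendRun c₂ (apply τ)) (2 + c₁) (s≤s z≤n) (s≤s (s≤s (≤-trans (<⇒≤ c₁<c₂) (m≤n⇒m≤1+n (m≤m+n c₂ m₂)))))))
... | e′ with trans (sym (appendRun-end c₁ (apply σ))) (trans e′ (appendRun-run c₂ (apply τ) c₁ c₁<c₂))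
... | ()

appendRunList-sizes : ∀ {c₁ c₂ m₁ m₂} σ τ → appendRunList c₁ m₁ σ ≡ appendRunList c₂ m₂ τ → m₁ ≡ m₂
appendRunList-sizes {c₁} {c₂} {m₁} {m₂} σ τ e with <-cmp c₁ c₂
... | tri< c₁<c₂ _ _ = ⊥-elim (appendRunList-run≢end σ τ c₁<c₂ e)
... | tri> _ _ c₂<c₁ = ⊥-elim (appendRunList-run≢end τ σ c₂<c₁ (sym e))
... | tri≈ _ refl _ = +-cancelˡ-≡ (3 + c₁) m₁ m₂
  (trans (sym (length-table (3 + c₁ + m₁) (appendRun c₁ (apply σ)))) (trans (cong length e) (length-table (3 + c₁ + m₂) (appendRun c₁ (apply τ)))))

insertTwoList≢appendRunList : ∀ {n′ c m′} σ τ → 2 ≤ apply τ 1 → insertTwoList n′ σ ≢ appendRunList c m′ τ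
insertTwoList≢appendRunList {n′} {c} {m′} σ τ 2≤τ₁ e = <⇒≱ (≤-trans (s≤s (s≤s (s≤s z≤n))) (runLift≥3+c c (apply τ 1) 2≤τ₁)) (≤-reflexive (begin
  runLift c (apply τ 1)                       ≡⟨ apply-table (3 + c + m′) (appendRun c (apply τ)) 1 ≤-refl (s≤s z≤n) ⟨
  apply (appendRunList c m′ τ) 1              ≡⟨ cong (λ w → apply w 1) e ⟨
  apply (insertTwoList n′ σ) 1                ≡⟨ apply-table (3 + n′) (insertTwo (apply σ)) 1 ≤-refl (s≤s z≤n) ⟩
  2                                           ∎))
  where open ≡-Reasoning

decomposed-unique : ∀ n′ → Unique (decomposed n′)
decomposed-unique n′ = Unique.++⁺
  (map-unique (insertTwoList n′) (λ σ∈ τ∈ → insertTwoList-injective n′ (length∈ σ∈) (length∈ τ∈)) (Bridge₁.𝒜-unique (2 + n′)))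
  (Unique.concat⁺ (Allₚ.map⁺ (All.universal runs-unique (upTo (suc n′)))) (AllPairsₚ.map⁺ (AllPairs.map runs-disjoint (Unique.upTo⁺ (suc n′)))))
  two-vs-run
  where
  length∈ : ∀ {k σ} → σ ∈ 𝒜₁ k → length σ ≡ k
  length∈ {k} σ∈ = proj₁ (Bridge₁.∈𝒜⁻ {k} σ∈)
  runs-unique : ∀ m′ → Unique (appendRunLists n′ m′)
  runs-unique m′ = map-unique (appendRunList (n′ ∸ m′) m′) (λ σ∈ τ∈ → appendRunList-injective (n′ ∸ m′) m′ (length∈ σ∈) (length∈ τ∈)) (Bridge₁.𝒜-unique (2 + m′))
  runs-disjoint : ∀ {m₁ m₂} → m₁ ≢ m₂ → Disjoint (appendRunLists n′ m₁) (appendRunLists n′ m₂)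
  runs-disjoint {m₁} {m₂} m₁≢m₂ (v∈₁ , v∈₂) with ∈-map⁻ (appendRunList (n′ ∸ m₁) m₁) v∈₁ | ∈-map⁻ (appendRunList (n′ ∸ m₂) m₂) v∈₂
  ... | σ , _ , refl | τ , _ , e = m₁≢m₂ (appendRunList-sizes σ τ e)
  two-vs-run : Disjoint (map (insertTwoList n′) (𝒜₁ (2 + n′))) (concatMap (appendRunLists n′) (upTo (suc n′)))
  two-vs-run (v∈₁ , v∈₂) with ∈-map⁻ (insertTwoList n′) v∈₁ | find (∈-concatMap⁻ (appendRunLists n′) {xs = upTo (suc n′)} v∈₂)
  ... | σ , _ , refl | m′ , _ , v∈appendRunLists with ∈-map⁻ (appendRunList (n′ ∸ m′) m′) v∈appendRunLists
  ...   | τ , τ∈ , e = insertTwoList≢appendRunList σ τ (orbit≥2 (s≤s z≤n) into injective cyclic 1 ≤-refl (s≤s (s≤s z≤n))) e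
    where open CyclicAvoider (proj₂ (Bridge₁.∈𝒜⁻ {2 + m′} τ∈))

a₁ : ℕ → ℕ
a₁ n = length (𝒜₁ n)

a₁-recurrence : ∀ n′ → a₁ (3 + n′) ≡ a₁ (2 + n′) + sum (map (λ m′ → a₁ (2 + m′)) (upTo (suc n′)))
a₁-recurrence n′ = begin
  a₁ (3 + n′)                  ≡⟨ same-members⇒same-length (Bridge₁.𝒜-unique (3 + n′)) (decomposed-unique n′)
                                    (𝒜₁⊆decomposed n′) (decomposed⊆𝒜₁ n′) ⟩
  length (decomposed n′)       ≡⟨ length-++ (map (insertTwoList n′) (𝒜₁ (2 + n′))) ⟩
  length (map (insertTwoList n′) (𝒜₁ (2 + n′))) + length (concatMap (appendRunLists n′) (upTo (suc n′)))
                               ≡⟨ cong₂ _+_ (length-map (insertTwoList n′) (𝒜₁ (2 + n′))) (length-concatMap (appendRunLists n′) (upTo (suc n′))) ⟩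
  a₁ (2 + n′) + sum (map (length ∘ appendRunLists n′) (upTo (suc n′)))
                               ≡⟨ cong (λ xs → a₁ (2 + n′) + sum xs) (map-cong (λ m′ → length-map (appendRunList (n′ ∸ m′) m′) (𝒜₁ (2 + m′))) (upTo (suc n′))) ⟩
  a₁ (2 + n′) + sum (map (λ m′ → a₁ (2 + m′)) (upTo (suc n′)))  ∎
  where open ≡-Reasoning

sum-upTo-suc : ∀ (f : ℕ → ℕ) n → sum (map f (upTo (suc n))) ≡ sum (map f (upTo n)) + f n
sum-upTo-suc f n = begin
  sum (map f (upTo (suc n)))          ≡⟨ cong (sum ∘ map f) (applyUpTo-∷ʳ id n) ⟨
  sum (map f (upTo n ++ [ n ]))       ≡⟨ cong sum (map-++ f (upTo n) [ n ]) ⟩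
  sum (map f (upTo n) ++ [ f n ])     ≡⟨ sum-++ (map f (upTo n)) [ f n ] ⟩
  sum (map f (upTo n)) + (f n + 0)    ≡⟨ cong (sum (map f (upTo n)) +_) (+-identityʳ (f n)) ⟩
  sum (map f (upTo n)) + f n          ∎
  where open ≡-Reasoning

fib-odd-sum : ∀ n → sum (map (λ m → fib (suc (m + m))) (upTo (suc n))) ≡ fib (suc (suc (n + n)))
fib-odd-sum zero = refl
fib-odd-sum (suc n) = begin
  sum (map odd (upTo (suc (suc n))))                    ≡⟨ sum-upTo-suc odd (suc n) ⟩
  sum (map odd (upTo (suc n))) + odd (suc n)            ≡⟨ cong₂ _+_ (fib-odd-sum n) (cong (fib ∘ suc) (+-suc (suc n) n)) ⟩
  fib (2 + (n + n)) + fib (3 + (n + n))                 ≡⟨ +-comm (fib (2 + (n + n))) _ ⟩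
  fib (4 + (n + n))                                     ≡⟨ cong (fib ∘ suc ∘ suc) (+-suc (suc n) n) ⟨
  fib (suc (suc (suc n + suc n)))                       ∎
  where
  open ≡-Reasoning
  odd : ℕ → ℕ
  odd m = fib (suc (m + m))

a₁-fib : ∀ k → a₁ (2 + k) ≡ fib (suc (k + k))
a₁-fib = <-rec (λ k → a₁ (2 + k) ≡ fib (suc (k + k))) step
  where
  open ≡-Reasoning
  step : ∀ k → (∀ {m} → m < k → a₁ (2 + m) ≡ fib (suc (m + m))) → a₁ (2 + k) ≡ fib (suc (k + k))
  step zero _ = refl
  step (suc n′) earlier = begin
    a₁ (3 + n′)                                                                  ≡⟨ a₁-recurrence n′ ⟩
    a₁ (2 + n′) + sum (map (λ m′ → a₁ (2 + m′)) (upTo (suc n′)))                 ≡⟨ cong₂ _+_ (earlier ≤-refl)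
                                                                                      (cong sum (map-cong-local (Allₚ.applyUpTo⁺₁ id (suc n′) earlier))) ⟩
    fib (suc (n′ + n′)) + sum (map (λ m → fib (suc (m + m))) (upTo (suc n′)))    ≡⟨ cong (fib (suc (n′ + n′)) +_) (fib-odd-sum n′) ⟩
    fib (suc (n′ + n′)) + fib (suc (suc (n′ + n′)))                              ≡⟨ +-comm (fib (suc (n′ + n′))) _ ⟩
    fib (suc (suc (suc (n′ + n′))))                                              ≡⟨ cong (fib ∘ suc ∘ suc) (+-suc n′ n′) ⟨
    fib (suc (suc n′ + suc n′))                                                  ∎

fib-index : ∀ k → 2 * (2 + k) ∸ 3 ≡ suc (k + k)
fib-index k = cong (_∸ 1) (trans (+-suc k _) (cong suc (trans (+-suc k _) (cong (suc ∘ (k +_)) (+-identityʳ k)))))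

a₁≡fib : ∀ n → 2 ≤ n → a₁ n ≡ fib (2 * n ∸ 3)
a₁≡fib (suc zero) (s≤s ())
a₁≡fib (suc (suc k)) _ = trans (a₁-fib k) (cong fib (sym (fib-index k)))

-- Inversion and the second family

record AreInverse (n : ℕ) (P Q : ℕ → ℕ) : Set where
  field
    P-into : MapsInto n P
    Q-into : MapsInto n Q
    Q∘P : ∀ i → 1 ≤ i → i ≤ n → Q (P i) ≡ i
    P∘Q : ∀ i → 1 ≤ i → i ≤ n → P (Q i) ≡ i

  P-injective : InjectiveOn n P
  P-injective i j 1≤i i≤n 1≤j j≤n e = trans (sym (Q∘P i 1≤i i≤n)) (trans (cong Q e) (Q∘P j 1≤j j≤n))

  Q-injective : InjectiveOn n Q
  Q-injective i j 1≤i i≤n 1≤j j≤n e = trans (sym (P∘Q i 1≤i i≤n)) (trans (cong P e) (P∘Q j 1≤j j≤n))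



inverse-unique : ∀ {n P Q R} → AreInverse n P Q → AreInverse n Q R → Agree n R P
inverse-unique {n} {P} {Q} {R} PQ QR i 1≤i i≤n = begin
  R i                    ≡⟨ AreInverse.P∘Q PQ (R i) (proj₁ (R-into i 1≤i i≤n)) (proj₂ (R-into i 1≤i i≤n)) ⟨
  P (Q (R i))            ≡⟨ cong P (AreInverse.P∘Q QR i 1≤i i≤n) ⟩
  P i                    ∎
  where
  open ≡-Reasoning
  R-into : MapsInto n R
  R-into = AreInverse.Q-into QR

module Inversion {n : ℕ} {P Q : ℕ → ℕ} (1≤n : 1 ≤ n) (inv : AreInverse n P Q) (cycP : Cyclic n P) where
  open AreInverse inv

  orbit-inverse : ∀ t → t ≤ n → orbit Q t ≡ orbit P (n ∸ t)
  orbit-inverse zero _ = sym (orbit-period 1≤n P-into P-injective cycP)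
  orbit-inverse (suc t) t<n = begin
    Q (orbit Q t)                      ≡⟨ cong Q (orbit-inverse t (<⇒≤ t<n)) ⟩
    Q (orbit P (n ∸ t))                ≡⟨ cong (Q ∘ orbit P) (+-∸-assoc 1 {n} {suc t} t<n) ⟩
    Q (P (orbit P (n ∸ suc t)))        ≡⟨ Q∘P _ (proj₁ (orbit-within 1≤n P-into (n ∸ suc t))) (proj₂ (orbit-within 1≤n P-into (n ∸ suc t))) ⟩
    orbit P (n ∸ suc t)                ∎
    where open ≡-Reasoning

  cyclic : Cyclic n Q
  cyclic = cyclic-if-no-early-return 1≤n Q-into Q-injective λ t 1≤t t<n →
    subst (2 ≤_) (sym (orbit-inverse t (<⇒≤ t<n))) (orbit≥2 1≤n P-into P-injective cycP (n ∸ t) (m<n⇒0<n∸m t<n) (∸-monoʳ-< 1≤t (<⇒≤ t<n)))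


  module _ {i j k l} (1≤i : 1 ≤ i) (i<j : i < j) (j<k : j < k) (k<l : k < l) (l≤n : l ≤ n) where
    private
      1≤j = ≤-trans 1≤i (<⇒≤ i<j)
      1≤k = ≤-trans 1≤j (<⇒≤ j<k)
      1≤l = ≤-trans 1≤k (<⇒≤ k<l)
      k≤n = ≤-trans (<⇒≤ k<l) l≤n
      j≤n = ≤-trans (<⇒≤ j<k) k≤n
      i≤n = ≤-trans (<⇒≤ i<j) j≤n
      P∘Q≡ : ∀ {x} → 1 ≤ x → x ≤ n → x ≡ P (Q x)
      P∘Q≡ 1≤x x≤n = sym (P∘Q _ 1≤x x≤n)
      1≤Q : ∀ {x} → 1 ≤ x → x ≤ n → 1 ≤ Q x
      1≤Q 1≤x x≤n = proj₁ (Q-into _ 1≤x x≤n)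
      Q≤n : ∀ {x} → 1 ≤ x → x ≤ n → Q x ≤ n
      Q≤n 1≤x x≤n = proj₂ (Q-into _ 1≤x x≤n)

    inverse-occurrence-4312∪4321 : Avoids₄ Occ3421∪4321 n P → ¬ Occ4312∪4321 (Q i) (Q j) (Q k) (Q l)
    inverse-occurrence-4312∪4321 avoid (Qj<Qi , Qk<Qj , Ql<Qj) with <-cmp (Q k) (Q l)
    ... | tri< Qk<Ql _ _ = avoid (Q k) (Q l) (Q j) (Q i) (1≤Q 1≤k k≤n) Qk<Ql Ql<Qj Qj<Qi (Q≤n 1≤i i≤n)
            (subst₄ Occ3421∪4321 (P∘Q≡ 1≤k k≤n) (P∘Q≡ 1≤l l≤n) (P∘Q≡ 1≤j j≤n) (P∘Q≡ 1≤i i≤n) (j<k , <-trans j<k k<l , i<j))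
    ... | tri≈ _ Qk≡Ql _ = <-irrefl (Q-injective k l 1≤k k≤n 1≤l l≤n Qk≡Ql) k<l
    ... | tri> _ _ Ql<Qk = avoid (Q l) (Q k) (Q j) (Q i) (1≤Q 1≤l l≤n) Ql<Qk Qk<Qj Qj<Qi (Q≤n 1≤i i≤n)
            (subst₄ Occ3421∪4321 (P∘Q≡ 1≤l l≤n) (P∘Q≡ 1≤k k≤n) (P∘Q≡ 1≤j j≤n) (P∘Q≡ 1≤i i≤n) (<-trans j<k k<l , j<k , i<j))

    inverse-occurrence-3421∪4321 : Avoids₄ Occ4312∪4321 n P → ¬ Occ3421∪4321 (Q i) (Q j) (Q k) (Q l)
    inverse-occurrence-3421∪4321 avoid (Qk<Qi , Qk<Qj , Ql<Qk) with <-cmp (Q i) (Q j)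
    ... | tri< Qi<Qj _ _ = avoid (Q l) (Q k) (Q i) (Q j) (1≤Q 1≤l l≤n) Ql<Qk Qk<Qi Qi<Qj (Q≤n 1≤j j≤n)
            (subst₄ Occ4312∪4321 (P∘Q≡ 1≤l l≤n) (P∘Q≡ 1≤k k≤n) (P∘Q≡ 1≤i i≤n) (P∘Q≡ 1≤j j≤n) (k<l , <-trans i<j j<k , j<k))
    ... | tri≈ _ Qi≡Qj _ = <-irrefl (Q-injective i j 1≤i i≤n 1≤j j≤n Qi≡Qj) i<j
    ... | tri> _ _ Qj<Qi = avoid (Q l) (Q k) (Q j) (Q i) (1≤Q 1≤l l≤n) Ql<Qk Qk<Qj Qj<Qi (Q≤n 1≤i i≤n)
            (subst₄ Occ4312∪4321 (P∘Q≡ 1≤l l≤n) (P∘Q≡ 1≤k k≤n) (P∘Q≡ 1≤j j≤n) (P∘Q≡ 1≤i i≤n) (k<l , j<k , <-trans i<j j<k))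

  avoids₃-reverse : ∀ {R : Rel₃} → (∀ {b c} → 1 ≤ b → 1 ≤ c → ¬ R c b 1) →
    Avoids₃ R n (orbit P) → Avoids₃ (λ a b c → R c b a) n (orbit Q)
  avoids₃-reverse {R} not-last-1 avoid zero j k _ _ _ =
    not-last-1 (proj₁ (orbit-within 1≤n Q-into j)) (proj₁ (orbit-within 1≤n Q-into k))
  avoids₃-reverse {R} not-last-1 avoid (suc i) j k i<j j<k k<n =
    avoid (n ∸ k) (n ∸ j) (n ∸ suc i) (∸-monoʳ-< j<k k≤n) (∸-monoʳ-< i<j j≤n) (∸-monoʳ-< (s≤s z≤n) i≤n)
    ∘ subst₃ R (orbit-inverse k k≤n) (orbit-inverse j j≤n) (orbit-inverse (suc i) i≤n)
    where
    k≤n = <⇒≤ k<n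
    j≤n = <⇒≤ (<-trans j<k k<n)
    i≤n = <⇒≤ (<-≤-trans i<j j≤n)

  inverse-avoider₁ : Avoider₁ n P → Avoider₂ n Q
  inverse-avoider₁ v = record
    { into = Q-into
    ; injective = Q-injective
    ; cyclic = cyclic
    ; avoids₄ = λ i j k l 1≤i i<j j<k k<l l≤n → inverse-occurrence-4312∪4321 1≤i i<j j<k k<l l≤n (CyclicAvoider.avoids₄ v)
    ; avoids₃ = avoids₃-reverse {Occ213} (λ _ 1≤c (_ , c<1) → <⇒≱ c<1 1≤c) (CyclicAvoider.avoids₃ v)
    }

  inverse-avoider₂ : Avoider₂ n P → Avoider₁ n Q
  inverse-avoider₂ v = record
    { into = Q-into
    ; injective = Q-injective
    ; cyclic = cyclic
    ; avoids₄ = λ i j k l 1≤i i<j j<k k<l l≤n → inverse-occurrence-3421∪4321 1≤i i<j j<k k<l l≤n (CyclicAvoider.avoids₄ v)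
    ; avoids₃ = avoids₃-reverse {Occ312} (λ 1≤b _ (b<1 , _) → <⇒≱ b<1 1≤b) (CyclicAvoider.avoids₃ v)
    }

indexOf : ℕ → List ℕ → ℕ
indexOf y [] = 0
indexOf y (x ∷ xs) with y ≟ x
... | yes _ = 1
... | no _ = suc (indexOf y xs)

indexOf-within : ∀ {y} xs → y ∈ xs → Within (length xs) (indexOf y xs)
indexOf-within {y} (x ∷ xs) y∈ with y ≟ x
... | yes _ = ≤-refl , s≤s z≤n
indexOf-within {y} (x ∷ xs) (here y≡x) | no y≢x = ⊥-elim (y≢x y≡x)
indexOf-within {y} (x ∷ xs) (there y∈xs) | no _ = s≤s z≤n , s≤s (proj₂ (indexOf-within xs y∈xs))

apply-indexOf : ∀ {y} xs → y ∈ xs → apply xs (indexOf y xs) ≡ y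
apply-indexOf {y} (x ∷ xs) y∈ with y ≟ x
... | yes y≡x = sym y≡x
apply-indexOf {y} (x ∷ xs) (here y≡x) | no y≢x = ⊥-elim (y≢x y≡x)
apply-indexOf {y} (x ∷ xs) (there y∈xs) | no _ with indexOf y xs | indexOf-within xs y∈xs | apply-indexOf xs y∈xs
... | suc k | _ | e = e

indexOf-apply : ∀ xs → Unique xs → ∀ i → 1 ≤ i → i ≤ length xs → indexOf (apply xs i) xs ≡ i
indexOf-apply (x ∷ xs) _ (suc zero) _ _ with x ≟ x
... | yes _ = refl
... | no x≢x = ⊥-elim (x≢x refl)
indexOf-apply (x ∷ xs) (x∉xs ∷ u) (suc (suc i)) _ (s≤s i+1≤n) with apply xs (suc i) ≟ x
... | yes y≡x = ⊥-elim (All.lookup x∉xs (apply-∈ xs (suc i) (s≤s z≤n) i+1≤n) (sym y≡x))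
... | no _ = cong suc (indexOf-apply xs u (suc i) (s≤s z≤n) i+1≤n)

inverse : List ℕ → List ℕ
inverse w = table (length w) (λ y → indexOf y w)

inverse-AreInverse : ∀ w → MapsInto (length w) (apply w) → InjectiveOn (length w) (apply w) → AreInverse (length w) (apply w) (apply (inverse w))
inverse-AreInverse w into inj = record
  { P-into = into
  ; Q-into = λ y 1≤y y≤n → subst (Within n) (sym (Q≡ y 1≤y y≤n)) (indexOf-within w (∈w y 1≤y y≤n))
  ; Q∘P = λ i 1≤i i≤n → trans (Q≡ (apply w i) (proj₁ (into i 1≤i i≤n)) (proj₂ (into i 1≤i i≤n))) (indexOf-apply w unique i 1≤i i≤n)
  ; P∘Q = λ y 1≤y y≤n → trans (cong (apply w) (Q≡ y 1≤y y≤n)) (apply-indexOf w (∈w y 1≤y y≤n))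
  }
  where
  n = length w
  Q≡ : ∀ y → 1 ≤ y → y ≤ n → apply (inverse w) y ≡ indexOf y w
  Q≡ = apply-table n (λ y → indexOf y w)
  unique : Unique w
  unique = subst Unique (table-apply w) (table-unique⁺ n (apply w) inj)
  ∈w : ∀ y → 1 ≤ y → y ≤ n → y ∈ w
  ∈w y 1≤y y≤n with injectiveOn⇒onto into inj y (1≤y , y≤n)
  ... | i , (1≤i , i≤n) , refl = apply-∈ w i 1≤i i≤n

inverse-involutive : ∀ w → MapsInto (length w) (apply w) → InjectiveOn (length w) (apply w) → inverse (inverse w) ≡ w
inverse-involutive w into inj = list-ext (trans (length-table (length (inverse w)) (λ y → indexOf y (inverse w))) length-inverse) refl
  (subst (λ k → Agree k (apply (inverse (inverse w))) (apply w)) length-inverse (inverse-unique PQ′ QR))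
  where
  length-inverse : length (inverse w) ≡ length w
  length-inverse = length-table (length w) (λ y → indexOf y w)
  PQ : AreInverse (length w) (apply w) (apply (inverse w))
  PQ = inverse-AreInverse w into inj
  PQ′ : AreInverse (length (inverse w)) (apply w) (apply (inverse w))
  PQ′ = subst (λ k → AreInverse k (apply w) (apply (inverse w))) (sym length-inverse) PQ
  QR : AreInverse (length (inverse w)) (apply (inverse w)) (apply (inverse (inverse w)))
  QR = inverse-AreInverse (inverse w) (AreInverse.Q-into PQ′) (AreInverse.Q-injective PQ′)

module Bridge₂ = Bridge p4312 p4321 p312 Occ4312∪4321 Occ312 refl refl refl iso4312⇒ iso4321⇒₂ ⇒iso4312∪4321
  (λ a b c iso _ b≢c _ → iso312⇒ a b c iso b≢c) ⇒iso312

𝒜₂ : ℕ → List (List ℕ)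
𝒜₂ n = 𝒜 n (p4312 ∷ p4321 ∷ []) p312

avoider-involutive : ∀ {R₄ R₃ n w} → length w ≡ n → CyclicAvoider R₄ R₃ n (apply w) → inverse (inverse w) ≡ w
avoider-involutive {w = w} refl v = inverse-involutive w (CyclicAvoider.into v) (CyclicAvoider.injective v)

inverse-∈𝒜₂ : ∀ {n w} → 1 ≤ n → w ∈ 𝒜₁ n → inverse w ∈ 𝒜₂ n
inverse-∈𝒜₂ {n} {w} 1≤n w∈ with Bridge₁.∈𝒜⁻ {n} w∈
... | refl , v = Bridge₂.∈𝒜⁺ (length-table (length w) (λ y → indexOf y w))
  (Inversion.inverse-avoider₁ 1≤n (inverse-AreInverse w V.into V.injective) V.cyclic v)
  where module V = CyclicAvoider v

inverse-∈𝒜₁ : ∀ {n w} → 1 ≤ n → w ∈ 𝒜₂ n → inverse w ∈ 𝒜₁ n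
inverse-∈𝒜₁ {n} {w} 1≤n w∈ with Bridge₂.∈𝒜⁻ {n} w∈
... | refl , v = Bridge₁.∈𝒜⁺ (length-table (length w) (λ y → indexOf y w))
  (Inversion.inverse-avoider₂ 1≤n (inverse-AreInverse w V.into V.injective) V.cyclic v)
  where module V = CyclicAvoider v

a₂≡a₁ : ∀ n → 1 ≤ n → length (𝒜₂ n) ≡ a₁ n
a₂≡a₁ n 1≤n = begin
  length (𝒜₂ n)                 ≡⟨ same-members⇒same-length (Bridge₂.𝒜-unique n) inverses-unique to from ⟩
  length (map inverse (𝒜₁ n))   ≡⟨ length-map inverse (𝒜₁ n) ⟩
  a₁ n                          ∎
  where
  open ≡-Reasoning
  involutive₁ : ∀ {w} → w ∈ 𝒜₁ n → inverse (inverse w) ≡ w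
  involutive₁ w∈ = let length-w , v = Bridge₁.∈𝒜⁻ {n} w∈ in avoider-involutive length-w v
  involutive₂ : ∀ {w} → w ∈ 𝒜₂ n → inverse (inverse w) ≡ w
  involutive₂ w∈ = let length-w , v = Bridge₂.∈𝒜⁻ {n} w∈ in avoider-involutive length-w v
  inverses-unique : Unique (map inverse (𝒜₁ n))
  inverses-unique = map-unique inverse (λ v∈ w∈ e → trans (sym (involutive₁ v∈)) (trans (cong inverse e) (involutive₁ w∈))) (Bridge₁.𝒜-unique n)
  to : ∀ {w} → w ∈ 𝒜₂ n → w ∈ map inverse (𝒜₁ n)
  to w∈ = subst (_∈ map inverse (𝒜₁ n)) (involutive₂ w∈) (∈-map⁺ inverse (inverse-∈𝒜₁ 1≤n w∈))
  from : ∀ {w} → w ∈ map inverse (𝒜₁ n) → w ∈ 𝒜₂ n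
  from w∈ with ∈-map⁻ inverse w∈
  ... | v , v∈ , refl = inverse-∈𝒜₂ 1≤n v∈

corollary3p5 : ∀ (n : ℕ) → 2 ≤ n →
    (a n ((3 ∷ 4 ∷ 2 ∷ 1 ∷ []) ∷ (4 ∷ 3 ∷ 2 ∷ 1 ∷ []) ∷ []) (2 ∷ 1 ∷ 3 ∷ []) ≡ fib (2 * n ∸ 3))
    × (a n ((4 ∷ 3 ∷ 1 ∷ 2 ∷ []) ∷ (4 ∷ 3 ∷ 2 ∷ 1 ∷ []) ∷ []) (3 ∷ 1 ∷ 2 ∷ []) ≡ fib (2 * n ∸ 3))
corollary3p5 n 2≤n = a₁≡fib n 2≤n , trans (a₂≡a₁ n (<⇒≤ 2≤n)) (a₁≡fib n 2≤n)
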